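{- Let $k\ge 2$ and let $G$ be the complete $k$-partite graph $K(4,2,\ldots,2)$ (one part of size $4$ and $k-1$ parts of size $2$). Then $h(G)=k$ if $k$ is odd and $h(G)=k+1$ if $k$ is even.
   Context: All graphs are finite and simple. A list assignment $L$ to a graph $G$ assigns a finite set $L(v)$ to each vertex $v$; a proper $L$-coloring is a map $\psi$ with $\psi(v)\in L(v)$ for all $v$ and $\psi(u)\ne\psi(v)$ for every edge $uv$. For a subgraph $H$ of $G$ and a color $\sigma$, let $H_\sigma$ denote the subgraph of $H$ induced by $\{v\in V(H):\sigma\in L(v)\}$, and let $\alpha$ denote the independence number (with $\alpha$ of the null graph equal to $0$). $G$ and $L$ satisfy Hall's condition if $\sum_{\sigma}\alpha(H_\sigma)\ge |V(H)|$ for every subgraph $H$ of $G$, the sum being over all colors. The Hall number $h(G)$ is the smallest positive integer $k$ such that $G$ has a proper $L$-coloring whenever $G$ and $L$ satisfy Hall's condition and $|L(v)|\ge k$ for every $v\in V(G)$. -}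

module Defs where

open import Data.Fin.Base using (Fin; zero; suc; splitAt)
open import Data.Fin.Properties using (all?) renaming (_≟_ to _≟ᶠ_)
open import Data.Fin.Subset
  using (Subset; inside; outside; _∈_; _⊆_; _∩_; ∣_∣) renaming (⊥ to ∅)
open import Data.Fin.Subset.Properties
  using (_∈?_; _⊆?_; ⊥⊆; ∉⊥; ∣⊥∣≡0; x∈p∩q⁺)
open import Data.List.Base
  using (List; []; _∷_; _++_; [_]; map; filter; length)
open import Data.List.Extrema.Nat using (max; argmax-sel; v≤max⁺)
open import Data.List.Membership.Propositional using (lose) renaming (_∈_ to _∈ˡ_)
open import Data.List.Membership.Propositional.Properties
  using (∈-map⁺; ∈-map⁻; ∈-++⁺ˡ; ∈-++⁺ʳ; ∈-filter⁺; ∈-filter⁻)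
open import Data.List.Relation.Unary.Any using (here)
open import Data.Nat.Base using (ℕ; zero; suc; _≤_; _<_)
open import Data.Nat.ListAction using (sum)
open import Data.Nat.Properties using (+-0-commutativeMonoid; ≤-refl)
open import Data.Product.Base using (∃-syntax; _×_; _,_; proj₁; proj₂)
open import Data.Sum.Base using (inj₁; inj₂; [_,_]′)
open import Data.Vec.Base using ([]; _∷_; tabulate; lookup)
open import Function.Base using (const; id; _∘_; _∘′_)
open import Level using (0ℓ)
open import Relation.Binary.Core using (Rel)
open import Relation.Binary.Definitions using (Decidable; Symmetric; Irreflexive)
open import Relation.Binary.PropositionalEquality
  using (_≡_; _≢_; refl; sym; trans)
open import Relation.Nullary.Decidable using (¬?; _×-dec_; _→-dec_)
open import Relation.Nullary.Negation using (¬_; contradiction)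
import Relation.Unary as U

open import Algebra.Properties.CommutativeMonoid.Sum +-0-commutativeMonoid
  using (sum-syntax)

private
  variable
    n c : ℕ

record Graph (n : ℕ) : Set₁ where
  field
    Adj    : Rel (Fin n) 0ℓ
    adj?   : Decidable Adj
    symm   : Symmetric Adj
    irrefl : Irreflexive _≡_ Adj

-- Subgraphs need not be induced.
record Subgraph (G : Graph n) : Set₁ where
  field
    verts : Subset n
    Adj   : Rel (Fin n) 0ℓ
    adj?  : Decidable Adj
    symm  : Symmetric Adj
    edge  : ∀ {u v} → Adj u v → Graph.Adj G u v
    left  : ∀ {u v} → Adj u v → u ∈ verts

open Subgraph using (verts)

-- The subgraph of H induced by the vertices of H lying in W.
induce : {G : Graph n} → Subgraph G → Subset n → Subgraph G
induce H W = record
  { verts = H.verts ∩ W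
  ; Adj   = λ u v → H.Adj u v × u ∈ W × v ∈ W
  ; adj?  = λ u v → H.adj? u v ×-dec (u ∈? W) ×-dec (v ∈? W)
  ; symm  = λ (uv , u∈W , v∈W) → H.symm uv , v∈W , u∈W
  ; edge  = H.edge ∘ proj₁
  ; left  = λ (uv , u∈W , _) → x∈p∩q⁺ (H.left uv , u∈W)
  }
  where module H = Subgraph H

Independent : {G : Graph n} → Subgraph G → Subset n → Set
Independent H S =
  S ⊆ verts H × (∀ u → u ∈ S → ∀ v → v ∈ S → ¬ Subgraph.Adj H u v)

independent? : {G : Graph n} (H : Subgraph G) → U.Decidable (Independent H)
independent? H S =
  (S ⊆? verts H) ×-dec
  all? (λ u → (u ∈? S) →-dec all? (λ v → (v ∈? S) →-dec ¬? (Subgraph.adj? H u v)))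

subsets : ∀ n → List (Subset n)
subsets zero    = [ [] ]
subsets (suc n) = map (outside ∷_) (subsets n) ++ map (inside ∷_) (subsets n)

α : {G : Graph n} → Subgraph G → ℕ
α {n} H = max 0 (map ∣_∣ (filter (independent? H) (subsets n)))

∈-subsets : (S : Subset n) → S ∈ˡ subsets n
∈-subsets []            = here refl
∈-subsets (outside ∷ S) = ∈-++⁺ˡ (∈-map⁺ (outside ∷_) (∈-subsets S))
∈-subsets (inside  ∷ S) =
  ∈-++⁺ʳ (map (outside ∷_) (subsets _)) (∈-map⁺ (inside ∷_) (∈-subsets S))

α-upper : {G : Graph n} (H : Subgraph G) {S : Subset n} →
          Independent H S → ∣ S ∣ ≤ α H
α-upper H {S} ind = v≤max⁺ 0 _ (inj₂ (lose
  (∈-map⁺ ∣_∣ (∈-filter⁺ (independent? H) (∈-subsets S) ind)) ≤-refl))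

α-attained : {G : Graph n} (H : Subgraph G) →
             ∃[ S ] Independent H S × ∣ S ∣ ≡ α H
α-attained {n} H
  with argmax-sel id 0 (map ∣_∣ (filter (independent? H) (subsets n)))
... | inj₁ α≡0 =
  ∅ , (⊥⊆ , λ _ u∈∅ → contradiction u∈∅ ∉⊥) , trans (∣⊥∣≡0 n) (sym α≡0)
... | inj₂ α∈ with ∈-map⁻ ∣_∣ α∈
...   | S , S∈ , α≡∣S∣ =
  S , proj₂ (∈-filter⁻ (independent? H) {xs = subsets n} S∈) , sym α≡∣S∣

-- The vertex set is finite and lists are finite, so all lists lie in a common
-- finite palette Fin c; colours on no list contribute nothing to Hall's sum.
ListAssignment : Graph n → ℕ → Set
ListAssignment {n} _ c = Fin n → Subset c

ProperColoring : (G : Graph n) → ListAssignment G c → (Fin n → Fin c) → Set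
ProperColoring G L ψ =
  (∀ v → ψ v ∈ L v) × (∀ u v → Graph.Adj G u v → ψ u ≢ ψ v)

Colorable : (G : Graph n) → ListAssignment G c → Set
Colorable G L = ∃[ ψ ] ProperColoring G L ψ

-- The set of vertices v with σ ∈ L v.
support : (G : Graph n) → ListAssignment G c → Fin c → Subset n
support G L σ = tabulate (λ v → lookup (L v) σ)

HallCondition : (G : Graph n) → ListAssignment G c → Set₁
HallCondition {c = c} G L =
  (H : Subgraph G) → ∣ verts H ∣ ≤ ∑[ σ < c ] α (induce H (support G L σ))

HallColorable : Graph n → ℕ → Set₁
HallColorable G k =
  ∀ c (L : ListAssignment G c) →
  HallCondition G L → (∀ v → k ≤ ∣ L v ∣) → Colorable G L

-- h(G) = k, as a relation: k is the least positive integer with HallColorable G k.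
HallNumber : Graph n → ℕ → Set₁
HallNumber G k =
  0 < k × HallColorable G k × (∀ m → 0 < m → HallColorable G m → k ≤ m)

part : (sizes : List ℕ) → Fin (sum sizes) → Fin (length sizes)
part (s ∷ sizes) v = [ const zero , suc ∘′ part sizes ]′ (splitAt s v)

-- The vertices are split into consecutive blocks of the given sizes.
completeMultipartite : (sizes : List ℕ) → Graph (sum sizes)
completeMultipartite sizes = record
  { Adj    = λ u v → part sizes u ≢ part sizes v
  ; adj?   = λ u v → ¬? (part sizes u ≟ᶠ part sizes v)
  ; symm   = λ u≁v → u≁v ∘ sym
  ; irrefl = λ { refl u≁u → u≁u refl }
  }

{-# OPTIONS --safe #-}
module Submission where

open import Defs
open import Data.Bool.Base using (Bool; true; false; T; _∧_; _∨_; not)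
open import Data.Bool.Properties using (T?; T-∧; T-∨; T-≡)
open import Data.Empty using (⊥)
open import Data.Fin.Base as Fin
  using (Fin; zero; suc; toℕ; fromℕ<; inject≤; _↑ˡ_; _↑ʳ_; splitAt; punchIn; punchOut;
         combine; remQuot)
open import Data.Fin.Patterns using (0F; 1F; 2F; 3F; 4F; 5F)
open import Data.Fin.Properties
  using (all?; any?; pigeonhole; toℕ<n; toℕ-injective; toℕ-fromℕ<; toℕ-inject≤;
         splitAt-↑ˡ; splitAt-↑ʳ; splitAt⁻¹-↑ˡ; splitAt⁻¹-↑ʳ; ↑ˡ-injective; ↑ʳ-injective;
         punchIn-punchOut; punchOut-injective; combine-remQuot; combine-injective)
  renaming (_≟_ to _≟ᶠ_)
open import Data.Fin.Subset using (Subset; inside; outside; ∣_∣; _∈_)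
open import Data.Fin.Subset.Properties using (anySubset?; x∈p∩q⁺)
open import Data.List.Base using (List; []; _∷_; replicate)
open import Data.Nat.Base
open import Data.Nat.Divisibility
  using (_∣_; _∤_; divides; _∣?_; _∣0; ∣m∣n⇒∣m+n; ∣-refl)
open import Data.Nat.ListAction using (sum)
open import Data.Nat.Properties
open import Data.Nat.Tactic.RingSolver using (solve-∀)
open import Data.Product.Base using (∃-syntax; _×_; _,_; proj₁; proj₂; map₁)
open import Data.Sum.Base using (_⊎_; inj₁; inj₂; [_,_]′; map₂)
open import Data.Vec.Base as Vec using (lookup; tabulate)
open import Data.Vec.Functional using (foldr) renaming ([] to ⟨⟩; _∷_ to infixr 5 _◂_)
open import Data.Vec.Properties using (lookup⇒[]=; []=⇒lookup; lookup∘tabulate)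
open import Function.Base using (_∘_; id; case_of_)
open import Function.Bundles using (Equivalence)
open import Function.Definitions using (Injective)
open import Relation.Binary.PropositionalEquality
open import Relation.Nullary.Decidable
  using (Dec; yes; no; ⌊_⌋; from-yes; map′; ¬?; _×-dec_; _⊎-dec_; _→-dec_;
         toWitness; fromWitness; toWitnessFalse; decidable-stable)
open import Relation.Nullary.Negation using (¬_; contradiction)

open import Algebra.Properties.CommutativeMonoid.Sum +-0-commutativeMonoid
  using (sum-syntax; ∑-distrib-+; ∑-comm)
open import Algebra.Properties.Semiring.Sum +-*-semiring using (*-distribˡ-sum)

-- If the vertices carrying any given colour induce a d-colourable graph and all
-- lists have size at least d, then Hall's condition holds: for each colour σ some
-- colour class contains at least 1/d of the vertices of H carrying σ. For even d
-- there are uncolourable lists of size d on the K(4,2,…,2) with d parts: the part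
-- of size 4 needs two colours out of one union of lists that the pairs all but
-- exhaust. If k = d + 1, the remaining pair gets colours of its own.
--
-- Upper bound: by induction on k, G is colourable from lists of size k if k is
-- odd or some list on the part of size 4 has k + 1 colours. If σ is common to
-- the whole part, use it there, the pairs being (k − 1)-choosable. If σ is common
-- to a pair, use it there; it misses a list of the part, which supplies the extra
-- colour if k − 1 is even. Otherwise the lists of each pair are disjoint, and a
-- system of distinct representatives is sought for the pairs and suitable
-- classes of the part that share a colour. Hall's marriage theorem leaves a single
-- bad case, with all lists inside the 2k colours of one pair, every colour in two
-- lists of the part, and a list of the pair that is a union of sets
-- (A ∩ B) ∪ (C ∩ D) with |A ∩ B| = |C ∩ D|, where {A,B} ∪ {C,D} are the lists of
-- the part. Then k is even.

private
  variable
    c m n r r′ : ℕ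

-- Sums over finite types and Boolean-valued finite sets

∑-mono-≤ : {f g : Fin n → ℕ} → (∀ i → f i ≤ g i) → ∑[ i < n ] f i ≤ ∑[ i < n ] g i
∑-mono-≤ {zero}  f≤g = z≤n
∑-mono-≤ {suc n} f≤g = +-mono-≤ (f≤g zero) (∑-mono-≤ (f≤g ∘ suc))

∑-mono-< : {f g : Fin n → ℕ} → (∀ i → f i ≤ g i) → ∀ j → f j < g j →
           ∑[ i < n ] f i < ∑[ i < n ] g i
∑-mono-< f≤g zero    f<g = +-mono-<-≤ f<g (∑-mono-≤ (f≤g ∘ suc))
∑-mono-< f≤g (suc j) f<g = +-mono-≤-< (f≤g zero) (∑-mono-< (f≤g ∘ suc) j f<g)

-- Boolean-valued, so that a pointwise claim about unions and intersections is a claim about Boolean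
-- variables and can be settled by a truth table.
FinSet : ℕ → Set
FinSet n = Fin n → Bool

infixr 6 _∪_
infixr 7 _∩_

_∪_ _∩_ : FinSet n → FinSet n → FinSet n
(p ∪ q) i = p i ∨ q i
(p ∩ q) i = p i ∧ q i

full : FinSet n
full _ = true

⁅_⁆ : Fin n → FinSet n
⁅ j ⁆ i = ⌊ i ≟ᶠ j ⌋

infixl 6 _─_
_─_ : FinSet n → Fin n → FinSet n
(p ─ j) i = p i ∧ not (⁅ j ⁆ i)

𝟙 : Bool → ℕ
𝟙 true  = 1
𝟙 false = 0

card : FinSet n → ℕ
card {zero}  p = 0
card {suc n} p = 𝟙 (p zero) + card (p ∘ suc)

card≡∑ : (p : FinSet n) → card p ≡ ∑[ i < n ] 𝟙 (p i)
card≡∑ {zero}  p = refl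
card≡∑ {suc n} p = cong (𝟙 (p zero) +_) (card≡∑ (p ∘ suc))

-- With these deciders, `from-yes` proves a pointwise inequality between indicators by evaluating
-- all truth assignments.
∀𝔹? : ∀ {P : Bool → Set} → (∀ b → Dec (P b)) → Dec (∀ b → P b)
∀𝔹? P? = map′ (λ { (f , t) false → f ; (f , t) true → t }) (λ h → h false , h true)
              (P? false ×-dec P? true)

∀𝔹²? : ∀ {P : Bool → Bool → Set} → (∀ a b → Dec (P a b)) → Dec (∀ a b → P a b)
∀𝔹²? P? = ∀𝔹? λ a → ∀𝔹? (P? a)

∀𝔹³? : ∀ {P : Bool → Bool → Bool → Set} →
       (∀ a b c → Dec (P a b c)) → Dec (∀ a b c → P a b c)
∀𝔹³? P? = ∀𝔹? λ a → ∀𝔹²? (P? a)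

∀𝔹⁴? : ∀ {P : Bool → Bool → Bool → Bool → Set} →
       (∀ a b c d → Dec (P a b c d)) → Dec (∀ a b c d → P a b c d)
∀𝔹⁴? P? = ∀𝔹? λ a → ∀𝔹³? (P? a)

∀𝔹⁵? : ∀ {P : Bool → Bool → Bool → Bool → Bool → Set} →
       (∀ a b c d e → Dec (P a b c d e)) → Dec (∀ a b c d e → P a b c d e)
∀𝔹⁵? P? = ∀𝔹? λ a → ∀𝔹⁴? (P? a)

∀𝔹⁶? : ∀ {P : Bool → Bool → Bool → Bool → Bool → Bool → Set} →
       (∀ a b c d e f → Dec (P a b c d e f)) → Dec (∀ a b c d e f → P a b c d e f)
∀𝔹⁶? P? = ∀𝔹? λ a → ∀𝔹⁵? (P? a)

𝟙-mono : ∀ {x y} → (T x → T y) → 𝟙 x ≤ 𝟙 y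
𝟙-mono {x} {y} =
  from-yes (∀𝔹²? λ x y → (T? x →-dec T? y) →-dec (𝟙 x ≤? 𝟙 y)) x y

-- The separate singleton clause avoids a trailing `+ 0`, so that sums of cardinalities in the
-- proofs match definitionally.
cards : List (FinSet n) → ℕ
cards []           = 0
cards (p ∷ [])     = card p
cards (p ∷ q ∷ ps) = card p + cards (q ∷ ps)

multiplicity : List (FinSet n) → Fin n → ℕ
multiplicity []           i = 0
multiplicity (p ∷ [])     i = 𝟙 (p i)
multiplicity (p ∷ q ∷ ps) i = 𝟙 (p i) + multiplicity (q ∷ ps) i

cards≡∑ : (ps : List (FinSet n)) → cards ps ≡ ∑[ i < n ] multiplicity ps i
cards≡∑ {n} []           = sym (∑-zero n)
  where
  ∑-zero : ∀ n → ∑[ i < n ] 0 ≡ 0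
  ∑-zero zero    = refl
  ∑-zero (suc n) = ∑-zero n
cards≡∑     (p ∷ [])     = card≡∑ p
cards≡∑     (p ∷ q ∷ ps) =
  trans (cong₂ _+_ (card≡∑ p) (cards≡∑ (q ∷ ps)))
        (sym (∑-distrib-+ (𝟙 ∘ p) (multiplicity (q ∷ ps))))

-- Double counting: inequalities between sums of cardinalities are checked pointwise.
cards-mono : (ps qs : List (FinSet n)) →
             (∀ i → multiplicity ps i ≤ multiplicity qs i) → cards ps ≤ cards qs
cards-mono ps qs le =
  subst₂ _≤_ (sym (cards≡∑ ps)) (sym (cards≡∑ qs)) (∑-mono-≤ le)

card-mono : {p q : FinSet n} → (∀ i → T (p i) → T (q i)) → card p ≤ card q
card-mono {p = p} {q} p⊆q = cards-mono (p ∷ []) (q ∷ []) (λ i → 𝟙-mono (p⊆q i))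

card-cong : {p q : FinSet n} → (∀ i → p i ≡ q i) → card p ≡ card q
card-cong p≗q = ≤-antisym (card-mono (λ i → subst T (p≗q i)))
                          (card-mono (λ i → subst T (sym (p≗q i))))

card-∅ : {p : FinSet n} → (∀ i → ¬ T (p i)) → card p ≡ 0
card-∅ {p = p} p-empty = n≤0⇒n≡0 (cards-mono (p ∷ []) [] (λ i → 𝟙-mono {y = false} (p-empty i)))

card-+ : ∀ m (S : FinSet (m + n)) → card S ≡ card (S ∘ (_↑ˡ n)) + card (S ∘ (m ↑ʳ_))
card-+ zero    S = refl
card-+ (suc m) S =
  trans (cong (𝟙 (S zero) +_) (card-+ m (S ∘ suc))) (sym (+-assoc (𝟙 (S zero)) _ _))

card-full : card (full {n}) ≡ n
card-full {zero}  = refl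
card-full {suc n} = cong suc (card-full {n})

card≤n : (p : FinSet n) → card p ≤ n
card≤n p = subst (card p ≤_) card-full (card-mono {p = p} {full} _)

card-⁅⁆ : (j : Fin n) → card ⁅ j ⁆ ≡ 1
card-⁅⁆ {suc n} zero    = cong suc (card-∅ {n} (λ _ ()))
card-⁅⁆ {suc n} (suc j) = trans (card-cong suc-≟) (card-⁅⁆ j)
  where
  suc-≟ : ∀ i → ⌊ suc i ≟ᶠ suc j ⌋ ≡ ⌊ i ≟ᶠ j ⌋
  suc-≟ i with i ≟ᶠ j
  ... | yes _ = refl
  ... | no  _ = refl

card-nonempty : {p : FinSet n} → 1 ≤ card p → ∃[ i ] T (p i)
card-nonempty {p = p} 1≤p with any? (λ i → T? (p i))
... | yes i∈p  = i∈p
... | no  ∄i   = contradiction (card-∅ (λ i i∈p → ∄i (i , i∈p))) (>⇒≢ 1≤p)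

card-─ : (p : FinSet n) (j : Fin n) → card p ≤ suc (card (p ─ j))
card-─ p j = subst (λ o → card p ≤ o + card (p ─ j)) (card-⁅⁆ j)
  (cards-mono (p ∷ []) (⁅ j ⁆ ∷ p ─ j ∷ []) (λ i →
    from-yes (∀𝔹²? λ x y → 𝟙 x ≤? 𝟙 y + 𝟙 (x ∧ not y)) (p i) (⁅ j ⁆ i)))

card-─-∉ : (p : FinSet n) {j : Fin n} → ¬ T (p j) → card p ≤ card (p ─ j)
card-─-∉ p {j} j∉p = card-mono helper
  where
  helper : ∀ i → T (p i) → T ((p ─ j) i)
  helper i i∈p with i ≟ᶠ j
  ... | yes refl = contradiction i∈p j∉p
  ... | no  _    = Equivalence.from T-∧ (i∈p , _)

∈-─⁻ : (p : FinSet n) {i j : Fin n} → T ((p ─ j) i) → T (p i) × i ≢ j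
∈-─⁻ p {i} {j} i∈ with i∈p , i∉j ← Equivalence.to (T-∧ {p i}) i∈ =
  i∈p , λ { refl → toWitnessFalse i∉j refl }

-- As a fold, a union over a concrete index type such as `Fin 3` unfolds to an explicit Boolean
-- expression; the case analyses on selected classes use this.
⋃ : FinSet n → (Fin n → FinSet c) → FinSet c
⋃ S F σ = foldr _∨_ false (λ j → S j ∧ F j σ)

∈-⋃⁺ : (S : FinSet n) (F : Fin n → FinSet c) {σ : Fin c} (j : Fin n) →
       T (S j) → T (F j σ) → T (⋃ S F σ)
∈-⋃⁺ S F zero    j∈S σ∈F = Equivalence.from T-∨ (inj₁ (Equivalence.from T-∧ (j∈S , σ∈F)))
∈-⋃⁺ S F (suc j) j∈S σ∈F =
  Equivalence.from T-∨ (inj₂ (∈-⋃⁺ (S ∘ suc) (F ∘ suc) j j∈S σ∈F))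

∈-⋃⁻ : (S : FinSet n) (F : Fin n → FinSet c) {σ : Fin c} →
       T (⋃ S F σ) → ∃[ j ] T (S j) × T (F j σ)
∈-⋃⁻ {suc n} S F σ∈ with Equivalence.to T-∨ σ∈
... | inj₁ h = zero , Equivalence.to T-∧ h
... | inj₂ h with ∈-⋃⁻ (S ∘ suc) (F ∘ suc) h
...   | j , j∈S , σ∈F = suc j , j∈S , σ∈F

⋃-cong : (F : Fin n → FinSet c) {S S′ : FinSet n} → (∀ j → S j ≡ S′ j) →
         ∀ σ → ⋃ S F σ ≡ ⋃ S′ F σ
⋃-cong {zero}  F S≗S′ σ = refl
⋃-cong {suc n} F S≗S′ σ =
  cong₂ _∨_ (cong (_∧ F zero σ) (S≗S′ zero)) (⋃-cong (F ∘ suc) (S≗S′ ∘ suc) σ)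

-- Hall's marriage theorem

MarriageCondition : (Fin n → FinSet c) → Set
MarriageCondition {n} F = (S : FinSet n) → card S ≤ card (⋃ S F)

-- The search runs over `Subset n`, where it is decidable. A function `S` is compared with its
-- tabulation, which agrees with it pointwise, hence the use of `⋃-cong`.
marriage? : (F : Fin n → FinSet c) →
            MarriageCondition F ⊎ ∃[ S ] card (⋃ S F) < card S
marriage? {n} F
  with anySubset? (λ (S : Subset n) → card (⋃ (lookup S) F) <? card (lookup S))
... | yes (S , violated) = inj₂ (lookup S , violated)
... | no  none           = inj₁ (λ S → ≮⇒≥ (λ lt → none (tabulate S ,
  subst₂ _<_
    (card-cong (⋃-cong F (λ j → sym (lookup∘tabulate S j))))
    (card-cong (λ j → sym (lookup∘tabulate S j))) lt)))

delete : (Fin n → FinSet c) → Fin n → Fin c → Fin n → FinSet c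
delete F j x i σ = F i σ ∧ not (⁅ j ⁆ i ∧ ⁅ x ⁆ σ)

module _ (F : Fin n → FinSet c) where

  delete⊆ : ∀ j x i σ → T (delete F j x i σ) → T (F i σ)
  delete⊆ j x i σ = proj₁ ∘ Equivalence.to T-∧

  delete-other : ∀ {j i} x {σ} → i ≢ j → T (F i σ) → T (delete F j x i σ)
  delete-other {j} {i} x i≢j σ∈F with i ≟ᶠ j
  ... | yes i≡j = contradiction i≡j i≢j
  ... | no  _   = Equivalence.from T-∧ (σ∈F , _)

  delete-colour : ∀ j {x} i {σ} → σ ≢ x → T (F i σ) → T (delete F j x i σ)
  delete-colour j {x} i {σ} σ≢x σ∈F with i ≟ᶠ j | σ ≟ᶠ x
  ... | _     | yes σ≡x = contradiction σ≡x σ≢x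
  ... | yes _ | no _    = Equivalence.from T-∧ (σ∈F , _)
  ... | no  _ | no _    = Equivalence.from T-∧ (σ∈F , _)

  delete-self : ∀ j x → ¬ T (delete F j x j x)
  delete-self j x x∈ with j ≟ᶠ j | x ≟ᶠ x | Equivalence.to (T-∧ {F j x}) x∈
  ... | yes _   | yes _   | _ , ()
  ... | yes _   | no x≢x  | _ = x≢x refl
  ... | no  j≢j | _       | _ = j≢j refl

  delete-smaller : ∀ {j x} → T (F j x) →
                   ∑[ i < n ] card (delete F j x i) < ∑[ i < n ] card (F i)
  delete-smaller {j} {x} x∈F =
    ∑-mono-< (λ i → card-mono (delete⊆ j x i)) j
      (subst₂ _<_ (sym (card≡∑ (delete F j x j))) (sym (card≡∑ (F j)))
        (∑-mono-< (λ σ → 𝟙-mono (delete⊆ j x j σ)) x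
          (𝟙-mono-< (delete-self j x) x∈F)))
    where
    𝟙-mono-< : ∀ {x y} → ¬ T x → T y → 𝟙 x < 𝟙 y
    𝟙-mono-< {true}          ¬x y = contradiction _ ¬x
    𝟙-mono-< {false} {true}  ¬x y = ≤-refl

  -- If `j` were outside `S`, the deletion would not affect the union over `S`, and `S` would
  -- already violate the condition for `F`.
  violator∋ : MarriageCondition F → ∀ j x S →
              card (⋃ S (delete F j x)) < card S → T (S j)
  violator∋ marriage j x S violated with T? (S j)
  ... | yes j∈S = j∈S
  ... | no  j∉S = contradiction
    (≤-trans (marriage S) (card-mono {p = ⋃ S F} (λ σ σ∈ → case ∈-⋃⁻ S F σ∈ of λ where
      (i , i∈S , σ∈F) → ∈-⋃⁺ S (delete F j x) i i∈S
        (delete-other x (λ { refl → j∉S i∈S }) σ∈F))))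
    (<⇒≱ violated)

  -- Rado: violators for the two deletions would, by submodularity, give a
  -- violator for F among S ∪ T and (S ∩ T) ─ j.
  no-two-violators : MarriageCondition F → ∀ j {x y} → x ≢ y →
    ∀ S → card (⋃ S (delete F j x)) < card S →
    ∀ T → ¬ (card (⋃ T (delete F j y)) < card T)
  no-two-violators marriage j {x} {y} x≢y S S-violates T′ T-violates = <-irrefl refl (begin-strict
    card P + card Q
      ≤⟨ cards-mono (P ∷ Q ∷ []) (R ∷ R′ ∷ []) pointwise ⟩
    card R + card R′
      <⟨ arith {p = card (S ∪ T′)} S-violates T-violates index ⟩
    card (S ∪ T′) + card ((S ∩ T′) ─ j)
      ≤⟨ +-mono-≤ (marriage (S ∪ T′)) (marriage ((S ∩ T′) ─ j)) ⟩
    card P + card Q ∎)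
    where
    open ≤-Reasoning
    P  = ⋃ (S ∪ T′) F
    Q  = ⋃ ((S ∩ T′) ─ j) F
    R  = ⋃ S (delete F j x)
    R′ = ⋃ T′ (delete F j y)
    j∈S = violator∋ marriage j x S S-violates
    j∈T = violator∋ marriage j y T′ T-violates

    P⊆ : ∀ σ → T (P σ) → T (R σ) ⊎ T (R′ σ)
    -- A colour of `F j` is lost in at most one of `R` and `R′`, because the deleted colours differ
    -- and `j` belongs to both violators.
    P⊆ σ σ∈P with i , i∈ , σ∈F ← ∈-⋃⁻ (S ∪ T′) F σ∈P = case i ≟ᶠ j of λ where
      (yes refl) → case σ ≟ᶠ x of λ where
        (no  σ≢x)  → inj₁ (∈-⋃⁺ S (delete F j x) j j∈S (delete-colour j j σ≢x σ∈F))
        (yes refl) → inj₂ (∈-⋃⁺ T′ (delete F j y) j j∈T (delete-colour j j x≢y σ∈F))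
      (no i≢j) → case Equivalence.to T-∨ i∈ of λ where
        (inj₁ i∈S) → inj₁ (∈-⋃⁺ S (delete F j x) i i∈S (delete-other x i≢j σ∈F))
        (inj₂ i∈T) → inj₂ (∈-⋃⁺ T′ (delete F j y) i i∈T (delete-other y i≢j σ∈F))

    Q⊆ : ∀ σ → T (Q σ) → T (R σ) × T (R′ σ)
    Q⊆ σ σ∈Q with ∈-⋃⁻ ((S ∩ T′) ─ j) F σ∈Q
    ... | i , i∈ , σ∈F with ∈-─⁻ (S ∩ T′) i∈
    ...   | i∈S∩T , i≢j with Equivalence.to T-∧ i∈S∩T
    ...     | i∈S , i∈T = ∈-⋃⁺ S (delete F j x) i i∈S (delete-other x i≢j σ∈F)
                        , ∈-⋃⁺ T′ (delete F j y) i i∈T (delete-other y i≢j σ∈F)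

    pointwise : ∀ σ → 𝟙 (P σ) + 𝟙 (Q σ) ≤ 𝟙 (R σ) + 𝟙 (R′ σ)
    pointwise σ = from-yes (∀𝔹⁴? λ p q r r′ →
        (T? p →-dec (T? r ⊎-dec T? r′)) →-dec ((T? q →-dec (T? r ×-dec T? r′)) →-dec
        (𝟙 p + 𝟙 q ≤? 𝟙 r + 𝟙 r′)))
      (P σ) (Q σ) (R σ) (R′ σ) (P⊆ σ) (Q⊆ σ)

    index : card S + card T′ ≤ card (S ∪ T′) + (card ((S ∩ T′) ─ j) + 1)
    index = subst (λ o → card S + card T′ ≤ card (S ∪ T′) + (card ((S ∩ T′) ─ j) + o)) (card-⁅⁆ j)
      (cards-mono (S ∷ T′ ∷ []) (S ∪ T′ ∷ (S ∩ T′) ─ j ∷ ⁅ j ⁆ ∷ []) (λ i →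
        from-yes (∀𝔹³? λ s t d → 𝟙 s + 𝟙 t ≤? 𝟙 (s ∨ t) + (𝟙 ((s ∧ t) ∧ not d) + 𝟙 d))
        (S i) (T′ i) (⁅ j ⁆ i)))

    -- The two strict inequalities gain 2 and the removal of `j` from the intersection costs 1, so
    -- the result is still strict.
    arith : ∀ {r r′ s t p q} → r < s → r′ < t → s + t ≤ p + (q + 1) → r + r′ < p + q
    arith {r} {r′} {s} {t} {p} {q} r<s r′<t s+t≤ = s≤s⁻¹ (begin-strict
      suc (r + r′)     <⟨ n<1+n _ ⟩
      2 + (r + r′)     ≡⟨ cong suc (+-suc r r′) ⟨
      suc r + suc r′   ≤⟨ +-mono-≤ r<s r′<t ⟩
      s + t            ≤⟨ s+t≤ ⟩
      p + (q + 1)      ≡⟨ cong (p +_) (+-comm q 1) ⟩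
      p + suc q        ≡⟨ +-suc p q ⟩
      suc (p + q)      ∎)

Transversal : (Fin n → FinSet c) → Set
Transversal {n} {c} F =
  ∃[ f ] (∀ i → T (F i (f i))) × Injective {A = Fin n} {B = Fin c} _≡_ _≡_ f

-- Rado's proof: as long as some set has two elements, one of them can be deleted while keeping the
-- marriage condition. The total size strictly drops, so its bound `N` serves as fuel.
marriage : (F : Fin n → FinSet c) → MarriageCondition F → Transversal F
marriage {n} {c} F = reduce _ F ≤-refl
  where
  -- The condition for one index makes every set nonempty. For two indices with the same element it
  -- would find two elements in a one-element union.
  singletons : (F : Fin n → FinSet c) → MarriageCondition F →
    (∀ i {x y} → T (F i x) → T (F i y) → x ≡ y) → Transversal F
  singletons F marriage F-unique = (λ i → proj₁ (elem i)) , (λ i → proj₂ (elem i)) , inj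
    where
    elem : ∀ i → ∃[ σ ] T (F i σ)
    elem i = card-nonempty (begin
      1                    ≡⟨ card-⁅⁆ i ⟨
      card ⁅ i ⁆
        ≤⟨ marriage ⁅ i ⁆ ⟩
      card (⋃ ⁅ i ⁆ F)
        ≤⟨ card-mono (λ σ σ∈ → case ∈-⋃⁻ ⁅ i ⁆ F σ∈ of λ where
             (j , j∈ , σ∈F) → subst (λ j → T (F j σ)) (toWitness j∈) σ∈F) ⟩
      card (F i) ∎)
      where open ≤-Reasoning

    inj : Injective _≡_ _≡_ (λ i → proj₁ (elem i))
    inj {i} {j} fi≡fj with i ≟ᶠ j
    ... | yes i≡j = i≡j
    ... | no  i≢j = contradiction 2≤1 (λ { (s≤s ()) })
      where
      open ≤-Reasoning
      φ = proj₁ (elem i)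
      unique : ∀ i {l σ} → l ≡ i → T (F l σ) → σ ≡ proj₁ (elem i)
      unique i refl σ∈F = F-unique i σ∈F (proj₂ (elem i))
      ⊆φ : ∀ σ → T (⋃ (⁅ i ⁆ ∪ ⁅ j ⁆) F σ) → T (⁅ φ ⁆ σ)
      ⊆φ σ σ∈ with l , l∈ , σ∈F ← ∈-⋃⁻ (⁅ i ⁆ ∪ ⁅ j ⁆) F σ∈
        with Equivalence.to (T-∨ {⁅ i ⁆ l}) l∈
      ... | inj₁ l≡i = fromWitness (unique i (toWitness l≡i) σ∈F)
      ... | inj₂ l≡j = fromWitness (trans (unique j (toWitness l≡j) σ∈F) (sym fi≡fj))
      disjoint : ∀ l → 𝟙 (⁅ i ⁆ l) + 𝟙 (⁅ j ⁆ l) ≤ 𝟙 ((⁅ i ⁆ ∪ ⁅ j ⁆) l)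
      disjoint l with l ≟ᶠ i | l ≟ᶠ j
      ... | yes refl | yes refl = contradiction refl i≢j
      ... | yes _    | no _     = ≤-refl
      ... | no _     | yes _    = ≤-refl
      ... | no _     | no _     = ≤-refl
      2≤1 : 2 ≤ 1
      2≤1 = begin
        2                           ≡⟨ cong₂ _+_ (card-⁅⁆ i) (card-⁅⁆ j) ⟨
        card ⁅ i ⁆ + card ⁅ j ⁆
          ≤⟨ cards-mono (⁅ i ⁆ ∷ ⁅ j ⁆ ∷ []) (⁅ i ⁆ ∪ ⁅ j ⁆ ∷ []) disjoint ⟩
        card (⁅ i ⁆ ∪ ⁅ j ⁆)
          ≤⟨ marriage (⁅ i ⁆ ∪ ⁅ j ⁆) ⟩
        card (⋃ (⁅ i ⁆ ∪ ⁅ j ⁆) F)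
          ≤⟨ card-mono ⊆φ ⟩
        card ⁅ φ ⁆
          ≡⟨ card-⁅⁆ φ ⟩
        1                           ∎

  restore : ∀ {F j x} → Transversal (delete F j x) → Transversal F
  restore {F} {j} {x} (f , f∈ , inj) = f , (λ i → delete⊆ F j x i (f i) (f∈ i)) , inj

  reduce : ∀ N F → ∑[ i < n ] card (F i) ≤ N → MarriageCondition F → Transversal F
  reduce N F size marriage
    with any? (λ j → any? (λ x → any? (λ y → T? (F j x) ×-dec T? (F j y) ×-dec ¬? (x ≟ᶠ y))))
  ... | no none = singletons F marriage (λ i {x} {y} x∈ y∈ → case x ≟ᶠ y of λ where
          (yes x≡y) → x≡y
          (no  x≢y) → contradiction (i , x , y , x∈ , y∈ , x≢y) none)
  ... | yes (j , x , y , x∈ , y∈ , x≢y) with N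
  ...   | zero   = contradiction (≤-trans (delete-smaller F x∈) size) λ ()
  ...   | suc N′ with marriage? (delete F j x) | marriage? (delete F j y)
  ...     | inj₁ ok | _ = restore {F} {j}
              (reduce N′ (delete F j x) (s≤s⁻¹ (≤-trans (delete-smaller F x∈) size)) ok)
  ...     | inj₂ _  | inj₁ ok = restore {F} {j}
              (reduce N′ (delete F j y) (s≤s⁻¹ (≤-trans (delete-smaller F y∈) size)) ok)
  ...     | inj₂ (S , vS) | inj₂ (S′ , vS′) =
              contradiction vS′ (no-two-violators F marriage j x≢y S vS S′)

-- Colourings from marriage

-- A list colouring of the join of an independent set of size r (lists X) with
-- m independent pairs (lists Y).
record Colouring (X : Fin r → FinSet c) (Y : Fin m → Fin 2 → FinSet c) : Set where
  field
    x   : Fin r → Fin c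
    y   : Fin m → Fin 2 → Fin c
    x∈  : ∀ j → T (X j (x j))
    y∈  : ∀ i s → T (Y i s (y i s))
    x≢y : ∀ j i s → x j ≢ y i s
    y-sep : ∀ i s j t → y i s ≡ y j t → i ≡ j

-- The vertices with lists X j, κ j = i, may share a colour from A i.
merge : {A : Fin r → FinSet c} {X : Fin r′ → FinSet c} {Y : Fin m → Fin 2 → FinSet c} →
        (κ : Fin r′ → Fin r) → (∀ j σ → T (A (κ j) σ) → T (X j σ)) →
        Colouring A Y → Colouring X Y
merge κ A⊆X C = record
  { x = x ∘ κ ; y = y ; x∈ = λ j → A⊆X j _ (x∈ (κ j)) ; y∈ = y∈
  ; x≢y = λ j → x≢y (κ j) ; y-sep = y-sep }
  where open Colouring C

module _ (A : Fin r → FinSet c) (Y : Fin m → Fin 2 → FinSet c) where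

  private
    U V : Fin m → FinSet c
    U i = Y i 0F
    V i = Y i 1F

  -- All `m + (m + r)` lists receive distinct representatives, so even the two vertices of a pair
  -- get different colours. A set of indices is split into its traces `SU`, `SV` and `SA` on the
  -- three groups.
  colouring-by-marriage :
    (∀ SU SV SA → card SU + (card SV + card SA) ≤ card (⋃ SU U ∪ ⋃ SV V ∪ ⋃ SA A)) →
    Colouring A Y
  colouring-by-marriage condition = record
    { x = f ∘ ιA
    ; y = y
    ; x∈ = λ j → subst (λ G → T (G (f (ιA j)))) (F-A j) (f∈ (ιA j))
    ; y∈ = λ { i 0F → subst (λ G → T (G (f (ιU i)))) (F-U i) (f∈ (ιU i))
             ; i 1F → subst (λ G → T (G (f (ιV i)))) (F-V i) (f∈ (ιV i)) }
    ; x≢y = λ { j i 0F eq → contradiction (inj eq) (↑ʳ≢↑ˡ (m ↑ʳ j) i)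
              ; j i 1F eq → contradiction (↑ʳ-injective m _ _ (inj eq)) (↑ʳ≢↑ˡ j i) }
    ; y-sep = λ { i 0F j 0F eq → ↑ˡ-injective _ i j (inj eq)
                ; i 0F j 1F eq → contradiction (sym (inj eq)) (↑ʳ≢↑ˡ (j ↑ˡ r) i)
                ; i 1F j 0F eq → contradiction (inj eq) (↑ʳ≢↑ˡ (i ↑ˡ r) j)
                ; i 1F j 1F eq → ↑ˡ-injective r i j (↑ʳ-injective m _ _ (inj eq)) }
    }
    where
    F : Fin (m + (m + r)) → FinSet c
    F = [ U , [ V , A ]′ ∘ splitAt m ]′ ∘ splitAt m

    ιU ιV : Fin m → Fin (m + (m + r))
    ιU i = i ↑ˡ (m + r)
    ιV i = m ↑ʳ (i ↑ˡ r)
    ιA : Fin r → Fin (m + (m + r))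
    ιA j = m ↑ʳ (m ↑ʳ j)

    F-U : ∀ i → F (ιU i) ≡ U i
    F-U i = cong [ U , [ V , A ]′ ∘ splitAt m ]′ (splitAt-↑ˡ m i (m + r))
    F-V : ∀ i → F (ιV i) ≡ V i
    F-V i = trans (cong [ U , [ V , A ]′ ∘ splitAt m ]′ (splitAt-↑ʳ m (m + r) (i ↑ˡ r)))
                  (cong [ V , A ]′ (splitAt-↑ˡ m i r))
    F-A : ∀ j → F (ιA j) ≡ A j
    F-A j = trans (cong [ U , [ V , A ]′ ∘ splitAt m ]′ (splitAt-↑ʳ m (m + r) (m ↑ʳ j)))
                  (cong [ V , A ]′ (splitAt-↑ʳ m r j))

    ↑ʳ≢↑ˡ : ∀ {n} (j : Fin n) (i : Fin m) → m ↑ʳ j ≢ i ↑ˡ n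
    ↑ʳ≢↑ˡ j i eq with () ←
      trans (sym (splitAt-↑ʳ m _ j)) (trans (cong (splitAt m) eq) (splitAt-↑ˡ m i _))

    F-condition : MarriageCondition F
    F-condition S = begin
      card S
        ≡⟨ card-+ m S ⟩
      card (S ∘ ιU) + card (S ∘ (m ↑ʳ_))
        ≡⟨ cong (card (S ∘ ιU) +_) (card-+ m (S ∘ (m ↑ʳ_))) ⟩
      card (S ∘ ιU) + (card (S ∘ ιV) + card (S ∘ ιA))
        ≤⟨ condition (S ∘ ιU) (S ∘ ιV) (S ∘ ιA) ⟩
      card (⋃ (S ∘ ιU) U ∪ ⋃ (S ∘ ιV) V ∪ ⋃ (S ∘ ιA) A)
        ≤⟨ card-mono ⊆⋃ ⟩
      card (⋃ S F) ∎
      where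
      open ≤-Reasoning
      from : ∀ {n} (ι : Fin n → Fin (m + (m + r))) (B : Fin n → FinSet c) →
             (∀ i → F (ι i) ≡ B i) → ∀ σ → T (⋃ (S ∘ ι) B σ) → T (⋃ S F σ)
      from ι B F-B σ σ∈ with i , i∈S , σ∈B ← ∈-⋃⁻ (S ∘ ι) B σ∈ =
        ∈-⋃⁺ S F (ι i) i∈S (subst (λ G → T (G σ)) (sym (F-B i)) σ∈B)
      ⊆⋃ : ∀ σ → T ((⋃ (S ∘ ιU) U ∪ ⋃ (S ∘ ιV) V ∪ ⋃ (S ∘ ιA) A) σ) → T (⋃ S F σ)
      ⊆⋃ σ σ∈ with Equivalence.to (T-∨ {⋃ (S ∘ ιU) U σ}) σ∈
      ... | inj₁ h = from ιU U F-U σ h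
      ... | inj₂ h with Equivalence.to (T-∨ {⋃ (S ∘ ιV) V σ}) h
      ...   | inj₁ h = from ιV V F-V σ h
      ...   | inj₂ h = from ιA A F-A σ h

    f   = proj₁ (marriage F F-condition)
    f∈  = proj₁ (proj₂ (marriage F F-condition))
    inj = proj₂ (proj₂ (marriage F F-condition))

    y : Fin m → Fin 2 → Fin c
    y i 0F = f (ιU i)
    y i 1F = f (ιV i)

  module _ (SU SV : FinSet m) (SA : FinSet r) where
    E = ⋃ SU U ∪ ⋃ SV V ∪ ⋃ SA A

    E⊇D : card (⋃ SA A) ≤ card E
    E⊇D = cards-mono (⋃ SA A ∷ []) (E ∷ []) (λ σ →
      from-yes (∀𝔹³? λ u v d → 𝟙 d ≤? 𝟙 (u ∨ (v ∨ d)))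
        (⋃ SU U σ) (⋃ SV V σ) (⋃ SA A σ))

    E⊇U∪D : ∀ i → T (SU i) → card (U i ∪ ⋃ SA A) ≤ card E
    E⊇U∪D i i∈ = card-mono (λ σ →
      from-yes (∀𝔹⁴? λ uᵢ u v d → (T? uᵢ →-dec T? u) →-dec (T? (uᵢ ∨ d) →-dec T? (u ∨ (v ∨ d))))
        (U i σ) (⋃ SU U σ) (⋃ SV V σ) (⋃ SA A σ) (∈-⋃⁺ SU U i i∈))

    E⊇V∪D : ∀ i → T (SV i) → card (V i ∪ ⋃ SA A) ≤ card E
    E⊇V∪D i i∈ = card-mono (λ σ →
      from-yes (∀𝔹⁴? λ vᵢ u v d → (T? vᵢ →-dec T? v) →-dec (T? (vᵢ ∨ d) →-dec T? (u ∨ (v ∨ d))))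
        (V i σ) (⋃ SU U σ) (⋃ SV V σ) (⋃ SA A σ) (∈-⋃⁺ SV V i i∈))

    E⊇U∪V∪D : ∀ i → T (SU i) → T (SV i) → card (U i ∪ V i ∪ ⋃ SA A) ≤ card E
    E⊇U∪V∪D i i∈SU i∈SV = card-mono (λ σ →
      from-yes (∀𝔹⁵? λ uᵢ vᵢ u v d → (T? uᵢ →-dec T? u) →-dec ((T? vᵢ →-dec T? v) →-dec
          (T? (uᵢ ∨ (vᵢ ∨ d)) →-dec T? (u ∨ (v ∨ d)))))
        (U i σ) (V i σ) (⋃ SU U σ) (⋃ SV V σ) (⋃ SA A σ)
        (∈-⋃⁺ SU U i i∈SU) (∈-⋃⁺ SV V i i∈SV))

card-∪ˡ : (p q : FinSet n) → card p ≤ card (p ∪ q)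
card-∪ˡ p q = cards-mono (p ∷ []) (p ∪ q ∷ []) (λ i →
  from-yes (∀𝔹²? λ x y → 𝟙 x ≤? 𝟙 (x ∨ y)) (p i) (q i))

card-partial : (SU SV : FinSet n) → (∀ i → ¬ T (SU i ∧ SV i)) → card SU + card SV ≤ n
card-partial {n} SU SV single = subst (card SU + card SV ≤_) card-full
  (cards-mono (SU ∷ SV ∷ []) (full {n} ∷ []) (λ i →
    from-yes (∀𝔹²? λ u v → ¬? (T? (u ∧ v)) →-dec (𝟙 u + 𝟙 v ≤? 1)) (SU i) (SV i) (single i)))

Disjoint : FinSet n → FinSet n → Set
Disjoint p q = ∀ i → ¬ T (p i ∧ q i)

card-disjoint : (p q : FinSet n) → Disjoint p q → card p + card q ≤ card (p ∪ q)
card-disjoint p q disjoint = cards-mono (p ∷ q ∷ []) (p ∪ q ∷ []) (λ i →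
  from-yes (∀𝔹²? λ x y → ¬? (T? (x ∧ y)) →-dec (𝟙 x + 𝟙 y ≤? 𝟙 (x ∨ y))) (p i) (q i) (disjoint i))

card-∪ˡ₃ : (p q d : FinSet n) → card (p ∪ q) ≤ card (p ∪ q ∪ d)
card-∪ˡ₃ p q d = cards-mono (p ∪ q ∷ []) (p ∪ q ∪ d ∷ []) (λ i →
  from-yes (∀𝔹³? λ x y z → 𝟙 (x ∨ y) ≤? 𝟙 (x ∨ (y ∨ z))) (p i) (q i) (d i))

-- A selection containing both lists of some pair sees at least 2m colours, as many as there are
-- lists. Any other nonempty selection has at most m lists, and a single list provides m colours.
disjoint-pairs-colouring : (Y : Fin m → Fin 2 → FinSet c) → (∀ i → Disjoint (Y i 0F) (Y i 1F)) →
  (∀ i s → m ≤ card (Y i s)) → Colouring {r = 0} (λ ()) Y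
disjoint-pairs-colouring {m} Y disjoint large = colouring-by-marriage (λ ()) Y condition
  where
  open ≤-Reasoning
  condition : ∀ SU SV SA → card SU + (card SV + card {0} SA) ≤ card (E (λ ()) Y SU SV SA)
  condition SU SV SA with any? (λ i → T? (SU i ∧ SV i))
  ... | yes (i , i∈) with i∈SU , i∈SV ← Equivalence.to (T-∧ {SU i}) i∈ = begin
    card SU + (card SV + 0)
      ≡⟨ cong (card SU +_) (+-identityʳ (card SV)) ⟩
    card SU + card SV
      ≤⟨ +-mono-≤ (≤-trans (card≤n SU) (large i 0F)) (≤-trans (card≤n SV) (large i 1F)) ⟩
    card (Y i 0F) + card (Y i 1F)
      ≤⟨ card-disjoint (Y i 0F) (Y i 1F) (disjoint i) ⟩
    card (Y i 0F ∪ Y i 1F)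
      ≤⟨ card-∪ˡ₃ (Y i 0F) (Y i 1F) _ ⟩
    _
      ≤⟨ E⊇U∪V∪D (λ ()) Y SU SV SA i i∈SU i∈SV ⟩
    _ ∎
  ... | no single with any? (λ i → T? (SU i ∨ SV i))
  ...   | no none = begin
    card SU + (card SV + 0)
      ≡⟨ cong₂ _+_ (card-∅ {p = SU} (λ i i∈ → none (i , Equivalence.from T-∨ (inj₁ i∈))))
           (cong (_+ 0) (card-∅ {p = SV} (λ i i∈ → none (i , Equivalence.from (T-∨ {SU i}) (inj₂ i∈))))) ⟩
    0                        ≤⟨ z≤n ⟩
    _                        ∎
  ...   | yes (i , i∈) = begin
    card SU + (card SV + 0)        ≡⟨ cong (card SU +_) (+-identityʳ (card SV)) ⟩
    card SU + card SV              ≤⟨ card-partial SU SV (λ i i∈ → single (i , i∈)) ⟩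
    m                              ≤⟨ m≤E ⟩
    _                              ∎
    where
    m≤E : m ≤ card (E (λ ()) Y SU SV SA)
    m≤E with Equivalence.to (T-∨ {SU i}) i∈
    ... | inj₁ i∈SU = ≤-trans (large i 0F) (≤-trans (card-∪ˡ (Y i 0F) _) (E⊇U∪D (λ ()) Y SU SV SA i i∈SU))
    ... | inj₂ i∈SV = ≤-trans (large i 1F) (≤-trans (card-∪ˡ (Y i 1F) _) (E⊇V∪D (λ ()) Y SU SV SA i i∈SV))

card-∌0 : (p : FinSet (suc n)) → ¬ T (p 0F) → card p ≡ card (p ∘ suc)
card-∌0 p 0∉p with p 0F
... | true  = contradiction _ 0∉p
... | false = refl

card≤n-∌0 : (p : FinSet (suc n)) → ¬ T (p 0F) → card p ≤ n
card≤n-∌0 p 0∉p = subst (_≤ _) (sym (card-∌0 p 0∉p)) (card≤n (p ∘ suc))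

-- Pairs with disjoint lists

module DisjointPairs {m c} (Y : Fin (suc m) → Fin 2 → FinSet c)
  (disjoint : ∀ i → Disjoint (Y i 0F) (Y i 1F)) (large : ∀ i s → 2 + m ≤ card (Y i s)) where

  -- The number of parts: `suc m` pairs and one further part. The pair `0F` stands for all pairs in
  -- what follows: a selection that misses it, or one of its lists where both would count, is
  -- smaller by one and needs no additional colour.
  k = 2 + m
  U₀ = Y 0F 0F
  V₀ = Y 0F 1F

  -- Conditions under which no violator of the marriage condition contains
  -- exactly s vertices outside the pairs, D being the union of their lists.
  data Ample (s : ℕ) (D : FinSet c) : Set where
    few   : s ≤ 1 → s ≤ card D → Ample s D
    two   : s ≤ 2 → s ≤ card D → 1 + k ≤ card (U₀ ∪ D) → 1 + k ≤ card (V₀ ∪ D) → Ample s D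
    three : s ≤ 3 → 2 + k ≤ card D → 1 + (k + k) ≤ card (U₀ ∪ V₀ ∪ D) → Ample s D
    many  : suc m + suc m + s ≤ card D → Ample s D

  W-large : ∀ i → k + k ≤ card (Y i 0F ∪ Y i 1F)
  W-large i = ≤-trans (+-mono-≤ (large i 0F) (large i 1F))
                      (card-disjoint (Y i 0F) (Y i 1F) (disjoint i))

  -- Let t pair lists be selected. If some pair is selected entirely, then t ≤ 2(k - 1) and the
  -- union has at least 2k colours, which leaves room for 2 classes. If each pair is met at most
  -- once, then t ≤ k - 1 against k colours, which leaves room for 1. With t = 0 only `D` counts.
  -- `Ample` provides the colours beyond this slack.
  colouring-by-ample : (A : Fin r → FinSet c) → (∀ SA → Ample (card SA) (⋃ SA A)) → Colouring A Y
  colouring-by-ample {r} A ample = colouring-by-marriage A Y condition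
    where
    open ≤-Reasoning

    2m+4 : ∀ m → suc m + suc m + 2 ≡ 2 + m + (2 + m)
    2m+4 = solve-∀
    2m+4′ : ∀ m → m + suc m + 3 ≡ 2 + m + (2 + m)
    2m+4′ = solve-∀
    2m+4″ : ∀ m → suc m + m + 3 ≡ 2 + m + (2 + m)
    2m+4″ = solve-∀
    2m+5 : ∀ m → suc m + suc m + 3 ≡ 1 + (2 + m + (2 + m))
    2m+5 = solve-∀

    condition : ∀ SU SV SA → card SU + (card SV + card SA) ≤ card (E A Y SU SV SA)
    condition SU SV SA = subst (_≤ card F) (+-assoc (card SU) (card SV) s) t+s≤
      where
      F = E A Y SU SV SA
      D = ⋃ SA A
      s = card SA
      t = card SU + card SV

      t≤ : t ≤ suc m + suc m
      t≤ = +-mono-≤ (card≤n SU) (card≤n SV)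

      D≤ : card D ≤ card F
      D≤ = E⊇D A Y SU SV SA

      pair-case : ∀ i → T (SU i) → T (SV i) → Ample s D → t + s ≤ card F
      pair-case i i∈SU i∈SV = λ where
          (few s≤1 _)         → upto-2 (≤-trans s≤1 (s≤s z≤n))
          (two s≤2 _ _ _)     → upto-2 s≤2
          (three s≤3 _ W∪D≥)  → upto-3 s≤3 W∪D≥
          (many D≥)           → ≤-trans (+-monoˡ-≤ s t≤) (≤-trans D≥ D≤)
        where
        k+k≤F : k + k ≤ card F
        k+k≤F = begin
          k + k                   ≤⟨ W-large i ⟩
          card (Y i 0F ∪ Y i 1F)  ≤⟨ card-∪ˡ₃ (Y i 0F) (Y i 1F) D ⟩
          _                       ≤⟨ E⊇U∪V∪D A Y SU SV SA i i∈SU i∈SV ⟩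
          card F                  ∎
        upto-2 : s ≤ 2 → t + s ≤ card F
        upto-2 s≤2 = begin
          t + s                ≤⟨ +-mono-≤ t≤ s≤2 ⟩
          suc m + suc m + 2    ≡⟨ 2m+4 m ⟩
          k + k                ≤⟨ k+k≤F ⟩
          card F               ∎
        upto-3 : s ≤ 3 → 1 + (k + k) ≤ card (U₀ ∪ V₀ ∪ D) → t + s ≤ card F
        upto-3 s≤3 W∪D≥ with T? (SU 0F) | T? (SV 0F)
        ... | yes 0∈SU | yes 0∈SV = begin
          t + s                   ≤⟨ +-mono-≤ t≤ s≤3 ⟩
          suc m + suc m + 3       ≡⟨ 2m+5 m ⟩
          1 + (k + k)             ≤⟨ W∪D≥ ⟩
          card (U₀ ∪ V₀ ∪ D)      ≤⟨ E⊇U∪V∪D A Y SU SV SA 0F 0∈SU 0∈SV ⟩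
          card F                  ∎
        ... | no  0∉SU | _ = begin
          t + s                   ≤⟨ +-mono-≤ (+-mono-≤ (card≤n-∌0 SU 0∉SU) (card≤n SV)) s≤3 ⟩
          m + suc m + 3           ≡⟨ 2m+4′ m ⟩
          k + k                   ≤⟨ k+k≤F ⟩
          card F                  ∎
        ... | _ | no  0∉SV = begin
          t + s                   ≤⟨ +-mono-≤ (+-mono-≤ (card≤n SU) (card≤n-∌0 SV 0∉SV)) s≤3 ⟩
          suc m + m + 3           ≡⟨ 2m+4″ m ⟩
          k + k                   ≤⟨ k+k≤F ⟩
          card F                  ∎

      single-case : ∀ i → T (SU i ∨ SV i) → (∀ i → ¬ T (SU i ∧ SV i)) →
                    Ample s D → t + s ≤ card F
      single-case i i∈ single = λ where
          (few s≤1 _)        → begin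
            t + s      ≤⟨ +-mono-≤ t≤₁ s≤1 ⟩
            suc m + 1  ≡⟨ +-comm (suc m) 1 ⟩
            k          ≤⟨ k≤F ⟩
            card F     ∎
          (two s≤2 _ U∪D≥ V∪D≥) → upto-2 s≤2 U∪D≥ V∪D≥
          (three s≤3 D≥ _) → begin
            t + s      ≤⟨ +-mono-≤ t≤₁ s≤3 ⟩
            suc m + 3  ≡⟨ +-comm (suc m) 3 ⟩
            2 + k      ≤⟨ D≥ ⟩
            card D     ≤⟨ D≤ ⟩
            card F     ∎
          (many D≥) → ≤-trans (+-monoˡ-≤ s t≤) (≤-trans D≥ D≤)
        where
        t≤₁ : t ≤ suc m
        t≤₁ = card-partial SU SV single
        k≤F : k ≤ card F
        k≤F with Equivalence.to (T-∨ {SU i}) i∈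
        ... | inj₁ i∈SU = ≤-trans (large i 0F) (≤-trans (card-∪ˡ (Y i 0F) _) (E⊇U∪D A Y SU SV SA i i∈SU))
        ... | inj₂ i∈SV = ≤-trans (large i 1F) (≤-trans (card-∪ˡ (Y i 1F) _) (E⊇V∪D A Y SU SV SA i i∈SV))
        upto-2 : s ≤ 2 → 1 + k ≤ card (U₀ ∪ D) → 1 + k ≤ card (V₀ ∪ D) → t + s ≤ card F
        upto-2 s≤2 U∪D≥ V∪D≥ with T? (SU 0F) | T? (SV 0F)
        ... | yes 0∈SU | _ = begin
          t + s          ≤⟨ +-mono-≤ t≤₁ s≤2 ⟩
          suc m + 2      ≡⟨ +-comm (suc m) 2 ⟩
          1 + k          ≤⟨ U∪D≥ ⟩
          card (U₀ ∪ D)  ≤⟨ E⊇U∪D A Y SU SV SA 0F 0∈SU ⟩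
          card F         ∎
        ... | _ | yes 0∈SV = begin
          t + s          ≤⟨ +-mono-≤ t≤₁ s≤2 ⟩
          suc m + 2      ≡⟨ +-comm (suc m) 2 ⟩
          1 + k          ≤⟨ V∪D≥ ⟩
          card (V₀ ∪ D)  ≤⟨ E⊇V∪D A Y SU SV SA 0F 0∈SV ⟩
          card F         ∎
        ... | no 0∉SU | no 0∉SV = begin
          t + s
            ≡⟨ cong (_+ s) (cong₂ _+_ (card-∌0 SU 0∉SU) (card-∌0 SV 0∉SV)) ⟩
          card (SU ∘ suc) + card (SV ∘ suc) + s
            ≤⟨ +-mono-≤ (card-partial (SU ∘ suc) (SV ∘ suc) (single ∘ suc)) s≤2 ⟩
          m + 2
            ≡⟨ +-comm m 2 ⟩
          k                                          ≤⟨ k≤F ⟩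
          card F                                     ∎

      none-case : (∀ i → ¬ T (SU i ∨ SV i)) → Ample s D → t + s ≤ card F
      none-case none = λ where
          (few _ s≤D)     → s≤ s≤D
          (two _ s≤D _ _) → s≤ s≤D
          (three s≤3 D≥ _) → s≤ (≤-trans s≤3 (≤-trans (s≤s (s≤s (s≤s z≤n))) D≥))
          (many D≥)       → s≤ (≤-trans (m≤n+m s _) D≥)
        where
        s≤ : s ≤ card D → t + s ≤ card F
        s≤ s≤D = subst (λ t → t + s ≤ card F)
          (sym (cong₂ _+_ (card-∅ {p = SU} (λ i i∈ → none i (Equivalence.from T-∨ (inj₁ i∈))))
                          (card-∅ {p = SV} (λ i i∈ → none i (Equivalence.from (T-∨ {SU i}) (inj₂ i∈))))))
          (≤-trans s≤D D≤)

      t+s≤ : t + s ≤ card F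
      t+s≤ with any? (λ i → T? (SU i ∧ SV i)) | any? (λ i → T? (SU i ∨ SV i))
      ... | yes (i , i∈) | _ = pair-case i (proj₁ i∈²) (proj₂ i∈²) (ample SA)
        where i∈² = Equivalence.to (T-∧ {SU i}) i∈
      ... | no no-pair | yes (i , i∈) = single-case i i∈ (λ i i∈ → no-pair (i , i∈)) (ample SA)
      ... | no _ | no none = none-case (λ i i∈ → none (i , i∈)) (ample SA)

card-pos : (p : FinSet n) (i : Fin n) → T (p i) → 1 ≤ card p
card-pos p i i∈p = subst (_≤ card p) (card-⁅⁆ i)
  (card-mono {p = ⁅ i ⁆} {p} (λ j j≡i → subst (λ l → T (p l)) (sym (toWitness {a? = j ≟ᶠ i} j≡i)) i∈p))

card≡0⇒∅ : {p : FinSet n} → card p ≡ 0 → ∀ i → ¬ T (p i)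
card≡0⇒∅ {p = p} ≡0 i i∈p = contradiction (card-pos p i i∈p) (<⇒≱ (s≤s (≤-reflexive ≡0)))

card-∪-∩ : (p q : FinSet n) → card p + card q ≤ card (p ∪ q) + card (p ∩ q)
card-∪-∩ p q = cards-mono (p ∷ q ∷ []) (p ∪ q ∷ p ∩ q ∷ []) (λ i →
  from-yes (∀𝔹²? λ x y → 𝟙 x + 𝟙 y ≤? 𝟙 (x ∨ y) + 𝟙 (x ∧ y)) (p i) (q i))

-- Joins of disjoint pairs with two, three or four classes

module DisjointPairsJoin {m c} (Y : Fin (suc m) → Fin 2 → FinSet c)
  (disjoint : ∀ i → Disjoint (Y i 0F) (Y i 1F)) (large : ∀ i s → 2 + m ≤ card (Y i s)) where

  open DisjointPairs Y disjoint large

  two′ : ∀ {s D} → s ≤ 2 → 1 + k ≤ card D → Ample s D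
  two′ {s} {D} s≤2 D≥ = two s≤2 (≤-trans s≤2 (≤-trans (s≤s (s≤s z≤n)) D≥)) (∪ʳ U₀) (∪ʳ V₀)
    where
    ∪ʳ : ∀ p → 1 + k ≤ card (p ∪ D)
    ∪ʳ p = ≤-trans D≥ (card-mono (λ σ → Equivalence.from (T-∨ {p σ}) ∘ inj₂))

  module _ (A B : FinSet c) where

    -- Disjointness gives two colours to the selection of both classes without pair lists. The last
    -- two hypotheses serve the selections that meet each pair at most once.
    two-classes : Disjoint A B → 1 ≤ card A → 1 ≤ card B →
                  1 + k ≤ card (U₀ ∪ A ∪ B) → 1 + k ≤ card (V₀ ∪ A ∪ B) →
                  Colouring (A ◂ B ◂ ⟨⟩) Y
    two-classes A∩B≡∅ A≥1 B≥1 U₀≥ V₀≥ =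
      colouring-by-ample (A ◂ B ◂ ⟨⟩) (λ SA → ample (SA 0F) (SA 1F))
      where
      ample : ∀ s₀ s₁ → Ample (𝟙 s₀ + (𝟙 s₁ + 0)) (λ σ → s₀ ∧ A σ ∨ (s₁ ∧ B σ ∨ false))
      ample false false = few z≤n z≤n
      ample true  false = few ≤-refl (≤-trans A≥1 (card-mono (λ σ →
        from-yes (∀𝔹? λ a → T? a →-dec T? (a ∨ false)) (A σ))))
      ample false true = few ≤-refl (≤-trans B≥1 (card-mono (λ σ →
        from-yes (∀𝔹? λ a → T? a →-dec T? (a ∨ false)) (B σ))))
      ample true true = two ≤-refl
        (≤-trans (+-mono-≤ A≥1 B≥1) (≤-trans (card-disjoint A B A∩B≡∅) (card-mono (λ σ →
          from-yes (∀𝔹²? λ a b → T? (a ∨ b) →-dec T? (a ∨ (b ∨ false))) (A σ) (B σ)))))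
        (≤-trans U₀≥ (pad U₀)) (≤-trans V₀≥ (pad V₀))
        where
        pad : ∀ P → card (P ∪ A ∪ B) ≤ card (λ σ → P σ ∨ (A σ ∨ (B σ ∨ false)))
        pad P = card-mono (λ σ →
          from-yes (∀𝔹³? λ p a b → T? (p ∨ (a ∨ b)) →-dec T? (p ∨ (a ∨ (b ∨ false))))
            (P σ) (A σ) (B σ))

  module _ (A B C : FinSet c) where

    -- Since `A` is nonempty and disjoint from the other two, adding it to `B`, to `C` or to their
    -- union gains a colour, which reaches the `1 + k` or `2 + k` that `Ample` requires.
    three-classes : Disjoint A B → Disjoint A C → 1 ≤ card A → k ≤ card B → k ≤ card C →
                    1 + k ≤ card (B ∪ C) → 1 + (k + k) ≤ card (U₀ ∪ V₀ ∪ A ∪ B ∪ C) →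
                    Colouring (A ◂ B ◂ C ◂ ⟨⟩) Y
    three-classes A∩B≡∅ A∩C≡∅ A≥1 B≥ C≥ B∪C≥ W≥ =
      colouring-by-ample (A ◂ B ◂ C ◂ ⟨⟩) (λ SA → ample (SA 0F) (SA 1F) (SA 2F))
      where
      pad : ∀ P → card P ≤ card (λ σ → P σ ∨ false)
      pad P = card-mono (λ σ → from-yes (∀𝔹? λ a → T? a →-dec T? (a ∨ false)) (P σ))
      pad₂ : ∀ P Q → card (P ∪ Q) ≤ card (λ σ → P σ ∨ (Q σ ∨ false))
      pad₂ P Q = card-mono (λ σ →
        from-yes (∀𝔹²? λ p q → T? (p ∨ q) →-dec T? (p ∨ (q ∨ false))) (P σ) (Q σ))
      A∩[B∪C]≡∅ : Disjoint A (B ∪ C)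
      A∩[B∪C]≡∅ σ = from-yes
        (∀𝔹³? λ a b c → ¬? (T? (a ∧ b)) →-dec (¬? (T? (a ∧ c)) →-dec ¬? (T? (a ∧ (b ∨ c)))))
        (A σ) (B σ) (C σ) (A∩B≡∅ σ) (A∩C≡∅ σ)
      1≤k : 1 ≤ k
      1≤k = s≤s z≤n

      ample : ∀ s₀ s₁ s₂ → Ample (𝟙 s₀ + (𝟙 s₁ + (𝟙 s₂ + 0)))
                (λ σ → s₀ ∧ A σ ∨ (s₁ ∧ B σ ∨ (s₂ ∧ C σ ∨ false)))
      ample false false false = few z≤n z≤n
      ample true  false false = few ≤-refl (≤-trans A≥1 (pad A))
      ample false true  false = few ≤-refl (≤-trans (≤-trans 1≤k B≥) (pad B))
      ample false false true  = few ≤-refl (≤-trans (≤-trans 1≤k C≥) (pad C))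
      ample true  true  false = two′ ≤-refl
        (≤-trans (+-mono-≤ A≥1 B≥) (≤-trans (card-disjoint A B A∩B≡∅) (pad₂ A B)))
      ample true  false true  = two′ ≤-refl
        (≤-trans (+-mono-≤ A≥1 C≥) (≤-trans (card-disjoint A C A∩C≡∅) (pad₂ A C)))
      ample false true  true  = two′ ≤-refl (≤-trans B∪C≥ (pad₂ B C))
      ample true  true  true  = three ≤-refl
        (≤-trans (+-mono-≤ A≥1 B∪C≥) (≤-trans (card-disjoint A (B ∪ C) A∩[B∪C]≡∅) (card-mono (λ σ →
          from-yes (∀𝔹³? λ a b c → T? (a ∨ (b ∨ c)) →-dec T? (a ∨ (b ∨ (c ∨ false))))
            (A σ) (B σ) (C σ)))))
        (≤-trans W≥ (card-mono (λ σ →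
          from-yes (∀𝔹⁵? λ u v a b c →
              T? (u ∨ (v ∨ (a ∨ (b ∨ c)))) →-dec T? (u ∨ (v ∨ (a ∨ (b ∨ (c ∨ false))))))
            (U₀ σ) (V₀ σ) (A σ) (B σ) (C σ))))

  module _ (A B C D : FinSet c) where

    -- Any s of the disjoint sets hold sk colours. For s ≥ 3 this is at least 3k ≥ 2(k - 1) + 4,
    -- enough for all the pair lists and all four classes at once.
    four-classes : Disjoint A B → Disjoint A C → Disjoint A D →
                   Disjoint B C → Disjoint B D → Disjoint C D →
                   k ≤ card A → k ≤ card B → k ≤ card C → k ≤ card D →
                   Colouring (A ◂ B ◂ C ◂ D ◂ ⟨⟩) Y
    four-classes A∩B A∩C A∩D B∩C B∩D C∩D A≥ B≥ C≥ D≥ =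
      colouring-by-ample (A ◂ B ◂ C ◂ D ◂ ⟨⟩)
        (λ SA → by-size _ (⋃ SA (A ◂ B ◂ C ◂ D ◂ ⟨⟩)) (card≤n SA)
          (big (SA 0F) (SA 1F) (SA 2F) (SA 3F)))
      where
      open ≤-Reasoning

      6+3m : ∀ m → 2 + m + (2 + m + (2 + m + 0)) ≡ suc m + suc m + 4 + m
      6+3m = solve-∀

      by-size : ∀ s E → s ≤ 4 → s * k ≤ card E → Ample s E
      by-size 0 E _ _ = few z≤n z≤n
      by-size 1 E _ E≥ = few ≤-refl (≤-trans (s≤s z≤n) E≥)
      by-size 2 E _ E≥ = two′ ≤-refl (begin
        1 + k       ≤⟨ +-monoˡ-≤ k {1} {k} (s≤s z≤n) ⟩
        k + k       ≡⟨ cong (k +_) (+-identityʳ k) ⟨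
        2 * k       ≤⟨ E≥ ⟩
        card E      ∎)
      by-size (suc (suc (suc s))) E s≤4 E≥ = many (begin
        suc m + suc m + (3 + s)  ≤⟨ +-monoʳ-≤ (suc m + suc m) s≤4 ⟩
        suc m + suc m + 4        ≤⟨ m≤m+n _ m ⟩
        suc m + suc m + 4 + m    ≡⟨ 6+3m m ⟨
        3 * k                    ≤⟨ *-monoˡ-≤ k {3} {3 + s} (m≤m+n 3 s) ⟩
        (3 + s) * k              ≤⟨ E≥ ⟩
        card E ∎)

      scale : ∀ s (P : FinSet c) → k ≤ card P → 𝟙 s * k ≤ card (λ σ → s ∧ P σ)
      scale true  P P≥ = ≤-trans (≤-reflexive (*-identityˡ k)) P≥
      scale false P P≥ = z≤n

      big : ∀ s₀ s₁ s₂ s₃ → (𝟙 s₀ + (𝟙 s₁ + (𝟙 s₂ + (𝟙 s₃ + 0)))) * k ≤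
              card (λ σ → s₀ ∧ A σ ∨ (s₁ ∧ B σ ∨ (s₂ ∧ C σ ∨ (s₃ ∧ D σ ∨ false))))
      big s₀ s₁ s₂ s₃ = begin
        (𝟙 s₀ + (𝟙 s₁ + (𝟙 s₂ + (𝟙 s₃ + 0)))) * k
          ≡⟨ distrib (𝟙 s₀) (𝟙 s₁) (𝟙 s₂) (𝟙 s₃) k ⟩
        𝟙 s₀ * k + (𝟙 s₁ * k + (𝟙 s₂ * k + 𝟙 s₃ * k))
          ≤⟨ +-mono-≤ (scale s₀ A A≥) (+-mono-≤ (scale s₁ B B≥)
               (+-mono-≤ (scale s₂ C C≥) (scale s₃ D D≥))) ⟩
        _ ≤⟨ cards-mono ((λ σ → s₀ ∧ A σ) ∷ (λ σ → s₁ ∧ B σ) ∷ (λ σ → s₂ ∧ C σ) ∷ (λ σ → s₃ ∧ D σ) ∷ [])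
               ((λ σ → s₀ ∧ A σ ∨ (s₁ ∧ B σ ∨ (s₂ ∧ C σ ∨ (s₃ ∧ D σ ∨ false)))) ∷ []) pointwise ⟩
        _ ∎
        where
        distrib : ∀ a b c d k → (a + (b + (c + (d + 0)))) * k ≡ a * k + (b * k + (c * k + d * k))
        distrib = solve-∀
        shrink : ∀ s t {a b} → ¬ T (a ∧ b) → ¬ T ((s ∧ a) ∧ (t ∧ b))
        shrink s t {a} {b} = from-yes (∀𝔹⁴? λ s t a b →
          ¬? (T? (a ∧ b)) →-dec ¬? (T? ((s ∧ a) ∧ (t ∧ b)))) s t a b
        pointwise : ∀ σ → 𝟙 (s₀ ∧ A σ) + (𝟙 (s₁ ∧ B σ) + (𝟙 (s₂ ∧ C σ) + 𝟙 (s₃ ∧ D σ))) ≤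
                          𝟙 (s₀ ∧ A σ ∨ (s₁ ∧ B σ ∨ (s₂ ∧ C σ ∨ (s₃ ∧ D σ ∨ false))))
        pointwise σ = from-yes (∀𝔹⁴? λ a b c d →
            ¬? (T? (a ∧ b)) →-dec (¬? (T? (a ∧ c)) →-dec (¬? (T? (a ∧ d)) →-dec
            (¬? (T? (b ∧ c)) →-dec (¬? (T? (b ∧ d)) →-dec (¬? (T? (c ∧ d)) →-dec
            (𝟙 a + (𝟙 b + (𝟙 c + 𝟙 d)) ≤? 𝟙 (a ∨ (b ∨ (c ∨ (d ∨ false)))))))))))
          (s₀ ∧ A σ) (s₁ ∧ B σ) (s₂ ∧ C σ) (s₃ ∧ D σ)
          (shrink s₀ s₁ (A∩B σ)) (shrink s₀ s₂ (A∩C σ)) (shrink s₀ s₃ (A∩D σ))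
          (shrink s₁ s₂ (B∩C σ)) (shrink s₁ s₃ (B∩D σ)) (shrink s₂ s₃ (C∩D σ))

-- The part of size 4 when every pair has disjoint lists

module FourDisjointPairs {m c} (Y : Fin (suc m) → Fin 2 → FinSet c)
  (disjoint : ∀ i → Disjoint (Y i 0F) (Y i 1F)) (large : ∀ i s → 2 + m ≤ card (Y i s)) where

  open DisjointPairs Y disjoint large using (k; U₀; V₀; W-large)
  open DisjointPairsJoin Y disjoint large

  private
    1+k≤k+k : 1 + k ≤ k + k
    1+k≤k+k = +-monoˡ-≤ k {1} {k} (s≤s z≤n)

    variable
      A B C D : FinSet c

  Colours : (A B C D : FinSet c) → Set
  Colours A B C D = Colouring (A ◂ B ◂ C ◂ D ◂ ⟨⟩) Y

  -- The part splits into two twos as AB|CD, AC|BD or AD|CB. Arguments are given for the first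
  -- pattern; `swap₁₂` and `swap₁₃` transfer them to the others, and `rotate` exchanges the two
  -- halves.
  swap₁₂ : Colours A C B D → Colours A B C D
  swap₁₂ = merge (0F ◂ 2F ◂ 1F ◂ 3F ◂ ⟨⟩) λ { 0F _ h → h ; 1F _ h → h ; 2F _ h → h ; 3F _ h → h }

  swap₁₃ : Colours A D C B → Colours A B C D
  swap₁₃ = merge (0F ◂ 3F ◂ 2F ◂ 1F ◂ ⟨⟩) λ { 0F _ h → h ; 1F _ h → h ; 2F _ h → h ; 3F _ h → h }

  swap₂₃ : Colours A B D C → Colours A B C D
  swap₂₃ = merge (0F ◂ 1F ◂ 3F ◂ 2F ◂ ⟨⟩) λ { 0F _ h → h ; 1F _ h → h ; 2F _ h → h ; 3F _ h → h }

  rotate : Colours C D A B → Colours A B C D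
  rotate = merge (2F ◂ 3F ◂ 0F ◂ 1F ◂ ⟨⟩) λ { 0F _ h → h ; 1F _ h → h ; 2F _ h → h ; 3F _ h → h }

  -- The situation that remains when no colour can be given to three vertices of the part.
  record Lists (A B C D : FinSet c) : Set where
    field
      at-most-2 : ∀ σ → 𝟙 (A σ) + (𝟙 (B σ) + (𝟙 (C σ) + 𝟙 (D σ))) ≤ 2
      A≥ : k ≤ card A
      B≥ : k ≤ card B
      C≥ : k ≤ card C
      D≥ : k ≤ card D

  lists-swap₁₂ : Lists A B C D → Lists A C B D
  lists-swap₁₂ {A} {B} {C} {D} L = record { at-most-2 = λ σ → from-yes
      (∀𝔹⁴? λ a b c d → (𝟙 a + (𝟙 b + (𝟙 c + 𝟙 d)) ≤? 2) →-dec (𝟙 a + (𝟙 c + (𝟙 b + 𝟙 d)) ≤? 2))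
      (A σ) (B σ) (C σ) (D σ) (at-most-2 σ)
    ; A≥ = A≥ ; B≥ = C≥ ; C≥ = B≥ ; D≥ = D≥ }
    where open Lists L

  lists-swap₁₃ : Lists A B C D → Lists A D C B
  lists-swap₁₃ {A} {B} {C} {D} L = record { at-most-2 = λ σ → from-yes
      (∀𝔹⁴? λ a b c d → (𝟙 a + (𝟙 b + (𝟙 c + 𝟙 d)) ≤? 2) →-dec (𝟙 a + (𝟙 d + (𝟙 c + 𝟙 b)) ≤? 2))
      (A σ) (B σ) (C σ) (D σ) (at-most-2 σ)
    ; A≥ = A≥ ; B≥ = D≥ ; C≥ = C≥ ; D≥ = B≥ }
    where open Lists L

  lists-rotate : Lists A B C D → Lists C D A B
  lists-rotate {A} {B} {C} {D} L = record { at-most-2 = λ σ → from-yes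
      (∀𝔹⁴? λ a b c d → (𝟙 a + (𝟙 b + (𝟙 c + 𝟙 d)) ≤? 2) →-dec (𝟙 c + (𝟙 d + (𝟙 a + 𝟙 b)) ≤? 2))
      (A σ) (B σ) (C σ) (D σ) (at-most-2 σ)
    ; A≥ = C≥ ; B≥ = D≥ ; C≥ = A≥ ; D≥ = B≥ }
    where open Lists L

  -- Three vertices share one colour and the fourth keeps its list. The two classes are disjoint, so
  -- together they have the `1 + k` colours that `two-classes` needs.
  triple : Disjoint (A ∩ B ∩ C) D → 1 ≤ card (A ∩ B ∩ C) → k ≤ card D → Colours A B C D
  triple {A} {B} {C} {D} disj ≥1 D≥ = merge (0F ◂ 0F ◂ 0F ◂ 1F ◂ ⟨⟩)
    (λ { 0F σ → from-yes (∀𝔹³? λ a b c → T? (a ∧ (b ∧ c)) →-dec T? a) (A σ) (B σ) (C σ)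
       ; 1F σ → from-yes (∀𝔹³? λ a b c → T? (a ∧ (b ∧ c)) →-dec T? b) (A σ) (B σ) (C σ)
       ; 2F σ → from-yes (∀𝔹³? λ a b c → T? (a ∧ (b ∧ c)) →-dec T? c) (A σ) (B σ) (C σ)
       ; 3F σ h → h })
    (two-classes (A ∩ B ∩ C) D disj ≥1 (≤-trans (s≤s z≤n) D≥) (enough U₀) (enough V₀))
    where
    enough : ∀ P → 1 + k ≤ card (P ∪ (A ∩ B ∩ C) ∪ D)
    enough P = ≤-trans (+-mono-≤ ≥1 D≥) (≤-trans (card-disjoint (A ∩ B ∩ C) D disj)
                 (card-mono (λ σ → Equivalence.from (T-∨ {P σ}) ∘ inj₂)))

  intersections-disjoint : Lists A B C D → Disjoint (A ∩ B) (C ∩ D)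
  intersections-disjoint {A} {B} {C} {D} L σ = from-yes
    (∀𝔹⁴? λ a b c d → (𝟙 a + (𝟙 b + (𝟙 c + 𝟙 d)) ≤? 2) →-dec ¬? (T? ((a ∧ b) ∧ (c ∧ d))))
    (A σ) (B σ) (C σ) (D σ) (Lists.at-most-2 L σ)

  intersection-disjoint : Lists A B C D → Disjoint (A ∩ B) (C ∪ D)
  intersection-disjoint {A} {B} {C} {D} L σ = from-yes
    (∀𝔹⁴? λ a b c d → (𝟙 a + (𝟙 b + (𝟙 c + 𝟙 d)) ≤? 2) →-dec ¬? (T? ((a ∧ b) ∧ (c ∨ d))))
    (A σ) (B σ) (C σ) (D σ) (Lists.at-most-2 L σ)

  share-two : Lists A B C D → 1 ≤ card (A ∩ B) → 1 ≤ card (C ∩ D) →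
              1 + k ≤ card (U₀ ∪ (A ∩ B) ∪ (C ∩ D)) → 1 + k ≤ card (V₀ ∪ (A ∩ B) ∪ (C ∩ D)) →
              Colours A B C D
  share-two {A} {B} {C} {D} L AB≥1 CD≥1 U₀≥ V₀≥ = merge (0F ◂ 0F ◂ 1F ◂ 1F ◂ ⟨⟩)
    (λ { 0F σ → proj₁ ∘ Equivalence.to T-∧ ; 1F σ → proj₂ ∘ Equivalence.to (T-∧ {A σ})
       ; 2F σ → proj₁ ∘ Equivalence.to T-∧ ; 3F σ → proj₂ ∘ Equivalence.to (T-∧ {C σ}) })
    (two-classes (A ∩ B) (C ∩ D) (intersections-disjoint L) AB≥1 CD≥1 U₀≥ V₀≥)

  -- By the bound on multiplicities a colour of `A ∩ B` lies in neither `C` nor `D`, which yields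
  -- the disjointness for `three-classes`.
  share-one : Lists A B C D → 1 ≤ card (A ∩ B) → 1 + k ≤ card (C ∪ D) →
              1 + (k + k) ≤ card (U₀ ∪ V₀ ∪ (A ∩ B) ∪ C ∪ D) → Colours A B C D
  share-one {A} {B} {C} {D} L AB≥1 C∪D≥ W≥ = merge (0F ◂ 0F ◂ 1F ◂ 2F ◂ ⟨⟩)
    (λ { 0F σ → proj₁ ∘ Equivalence.to T-∧ ; 1F σ → proj₂ ∘ Equivalence.to (T-∧ {A σ})
       ; 2F σ h → h ; 3F σ h → h })
    (three-classes (A ∩ B) C D
      (λ σ h → intersection-disjoint L σ (from-yes
        (∀𝔹³? λ p c d → T? (p ∧ c) →-dec T? (p ∧ (c ∨ d))) ((A ∩ B) σ) (C σ) (D σ) h))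
      (λ σ h → intersection-disjoint L σ (from-yes
        (∀𝔹³? λ p c d → T? (p ∧ d) →-dec T? (p ∧ (c ∨ d))) ((A ∩ B) σ) (C σ) (D σ) h))
      AB≥1 (Lists.C≥ L) (Lists.D≥ L) C∪D≥ W≥)

  ∩-large : k ≤ card A → k ≤ card B → card (A ∪ B) ≤ k → k ≤ card (A ∩ B)
  ∩-large {A} {B} A≥ B≥ A∪B≤k = +-cancelˡ-≤ k _ _
    (≤-trans (+-mono-≤ A≥ B≥) (≤-trans (card-∪-∩ A B) (+-monoˡ-≤ _ A∪B≤k)))

  -- Here `C` and `D` coincide, so `C ∩ D` has k colours. If `A ∪ B` has more than k, these are
  -- disjoint from `C ∩ D` and sharing on C, D alone has 2k + 1 colours available. Otherwise `A ∩ B`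
  -- has k colours as well, and sharing on both halves works.
  tight : Lists A B C D → card (C ∪ D) ≤ k → Colours A B C D
  tight {A} {B} {C} {D} L C∪D≤k with 1 + k ≤? card (A ∪ B)
  ... | yes A∪B≥ = rotate (share-one (lists-rotate L) (≤-trans (s≤s z≤n) CD≥) A∪B≥ (begin
    1 + (k + k)
      ≡⟨ +-suc k k ⟨
    k + (1 + k)
      ≤⟨ +-mono-≤ CD≥ A∪B≥ ⟩
    card (C ∩ D) + card (A ∪ B)
      ≤⟨ card-disjoint (C ∩ D) (A ∪ B) (intersection-disjoint (lists-rotate L)) ⟩
    card ((C ∩ D) ∪ A ∪ B)
      ≤⟨ card-mono (λ σ →
           from-yes (∀𝔹³? λ u v x → T? x →-dec T? (u ∨ (v ∨ x)))
             (U₀ σ) (V₀ σ) (((C ∩ D) ∪ A ∪ B) σ)) ⟩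
    card (U₀ ∪ V₀ ∪ (C ∩ D) ∪ A ∪ B) ∎))
    where
    open ≤-Reasoning
    CD≥ = ∩-large (Lists.C≥ L) (Lists.D≥ L) C∪D≤k
  ... | no A∪B≱ = share-two L (≤-trans (s≤s z≤n) AB≥) (≤-trans (s≤s z≤n) CD≥) (enough U₀) (enough V₀)
    where
    CD≥ = ∩-large (Lists.C≥ L) (Lists.D≥ L) C∪D≤k
    AB≥ = ∩-large (Lists.A≥ L) (Lists.B≥ L) (s≤s⁻¹ (≰⇒> A∪B≱))
    enough : ∀ P → 1 + k ≤ card (P ∪ (A ∩ B) ∪ (C ∩ D))
    enough P = ≤-trans 1+k≤k+k (≤-trans (+-mono-≤ AB≥ CD≥)
      (≤-trans (card-disjoint (A ∩ B) (C ∩ D) (intersections-disjoint L))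
        (card-mono (λ σ → Equivalence.from (T-∨ {P σ}) ∘ inj₂))))

  -- Since `U₀` and `V₀` are disjoint with at least k colours each, a bound `k + k` on this set
  -- confines the four lists to the colours of the pair `0F`, and leaves `U₀` and `V₀` exactly k
  -- colours each.
  Z : (A B C D : FinSet c) → FinSet c
  Z A B C D = U₀ ∪ V₀ ∪ A ∪ B ∪ C ∪ D

  -- If neither half can share on its own, the two unions tested below have at most 2k colours each.
  -- Their union is `Z`, and both contain `U₀ ∪ V₀` with its 2k colours, so by submodularity `Z` has
  -- at most 2k.
  share-or-confined : Lists A B C D → 1 + k ≤ card (A ∪ B) → 1 + k ≤ card (C ∪ D) →
                      1 ≤ card (A ∩ B) → Colours A B C D ⊎ card (Z A B C D) ≤ k + k
  share-or-confined {A} {B} {C} {D} L A∪B≥ C∪D≥ AB≥1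
    with 1 + (k + k) ≤? card (U₀ ∪ V₀ ∪ (A ∩ B) ∪ C ∪ D)
       | 1 + (k + k) ≤? card (U₀ ∪ V₀ ∪ (C ∩ D) ∪ A ∪ B)
  ... | yes P≥ | _ = inj₁ (share-one L AB≥1 C∪D≥ P≥)
  ... | no  P≱ | yes Q≥ = inj₁ (rotate (share-one (lists-rotate L) CD≥1 A∪B≥ Q≥))
    where
    open ≤-Reasoning
    -- By `P≱` the disjoint sets `A ∩ B` and `C ∪ D` have at most 2k colours in total, at least one
    -- of them in `A ∩ B`. So `C ∪ D` is too small for `C` and `D` to be disjoint.
    CD≥1 : 1 ≤ card (C ∩ D)
    CD≥1 = +-cancelˡ-≤ (k + k) _ _ (begin
      k + k + 1
        ≤⟨ +-mono-≤ (≤-trans (+-mono-≤ (Lists.C≥ L) (Lists.D≥ L)) (card-∪-∩ C D)) AB≥1 ⟩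
      card (C ∪ D) + card (C ∩ D) + card (A ∩ B)
        ≡⟨ shuffle (card (C ∪ D)) (card (C ∩ D)) (card (A ∩ B)) ⟩
      card (A ∩ B) + card (C ∪ D) + card (C ∩ D)
        ≤⟨ +-monoˡ-≤ (card (C ∩ D)) (card-disjoint (A ∩ B) (C ∪ D) (intersection-disjoint L)) ⟩
      card ((A ∩ B) ∪ C ∪ D) + card (C ∩ D)
        ≤⟨ +-monoˡ-≤ (card (C ∩ D)) (card-mono (λ σ →
             from-yes (∀𝔹³? λ u v x → T? x →-dec T? (u ∨ (v ∨ x)))
               (U₀ σ) (V₀ σ) (((A ∩ B) ∪ C ∪ D) σ))) ⟩
      card (U₀ ∪ V₀ ∪ (A ∩ B) ∪ C ∪ D) + card (C ∩ D)
        ≤⟨ +-monoˡ-≤ (card (C ∩ D)) (s≤s⁻¹ (≰⇒> P≱)) ⟩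
      k + k + card (C ∩ D) ∎)
      where
      shuffle : ∀ x y z → x + y + z ≡ z + x + y
      shuffle = solve-∀
  ... | no  P≱ | no Q≱ = inj₂ (+-cancelˡ-≤ (k + k) _ _ (begin
    k + k + card (Z A B C D)
      ≤⟨ +-monoˡ-≤ (card (Z A B C D)) (W-large 0F) ⟩
    card (U₀ ∪ V₀) + card (Z A B C D)
      ≤⟨ cards-mono (U₀ ∪ V₀ ∷ Z A B C D ∷ []) (P ∷ Q ∷ []) (λ σ →
           from-yes (∀𝔹⁶? λ u v a b c d → 𝟙 (u ∨ v) + 𝟙 (u ∨ (v ∨ (a ∨ (b ∨ (c ∨ d))))) ≤?
             𝟙 (u ∨ (v ∨ ((a ∧ b) ∨ (c ∨ d)))) + 𝟙 (u ∨ (v ∨ ((c ∧ d) ∨ (a ∨ b)))))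
           (U₀ σ) (V₀ σ) (A σ) (B σ) (C σ) (D σ)) ⟩
    card P + card Q
      ≤⟨ +-mono-≤ (s≤s⁻¹ (≰⇒> P≱)) (s≤s⁻¹ (≰⇒> Q≱)) ⟩
    k + k + (k + k) ∎))
    where
    open ≤-Reasoning
    P = U₀ ∪ V₀ ∪ (A ∩ B) ∪ C ∪ D
    Q = U₀ ∪ V₀ ∪ (C ∩ D) ∪ A ∪ B

  Z-permute : ∀ {A B C D A′ B′ C′ D′ : FinSet c} →
    (∀ σ → T (A σ ∨ (B σ ∨ (C σ ∨ D σ))) → T (A′ σ ∨ (B′ σ ∨ (C′ σ ∨ D′ σ)))) →
    card (Z A′ B′ C′ D′) ≤ k + k → card (Z A B C D) ≤ k + k
  Z-permute {A} {B} {C} {D} {A′} {B′} {C′} {D′} sub = ≤-trans (card-mono (λ σ →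
    from-yes (∀𝔹⁴? λ u v x y → (T? x →-dec T? y) →-dec (T? (u ∨ (v ∨ x)) →-dec T? (u ∨ (v ∨ y))))
      (U₀ σ) (V₀ σ) ((A ∪ B ∪ C ∪ D) σ) ((A′ ∪ B′ ∪ C′ ∪ D′) σ) (sub σ)))

  Z-rotate : card (Z A B C D) ≤ k + k → card (Z C D A B) ≤ k + k
  Z-rotate {A} {B} {C} {D} = Z-permute {C} {D} {A} {B} {A} {B} {C} {D} (λ σ → from-yes
    (∀𝔹⁴? λ a b c d → T? (c ∨ (d ∨ (a ∨ b))) →-dec T? (a ∨ (b ∨ (c ∨ d))))
    (A σ) (B σ) (C σ) (D σ))

  pairing : Lists A B C D →
    Colours A B C D ⊎ card (Z A B C D) ≤ k + k ⊎ card (A ∩ B) ≡ 0 × card (C ∩ D) ≡ 0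
  pairing {A} {B} {C} {D} L with 1 + k ≤? card (A ∪ B) | 1 + k ≤? card (C ∪ D)
  ... | no A∪B≱ | _ = inj₁ (rotate (tight (lists-rotate L) (s≤s⁻¹ (≰⇒> A∪B≱))))
  ... | yes _ | no C∪D≱ = inj₁ (tight L (s≤s⁻¹ (≰⇒> C∪D≱)))
  ... | yes A∪B≥ | yes C∪D≥ with 1 ≤? card (A ∩ B) | 1 ≤? card (C ∩ D)
  ...   | yes AB≥1 | _ = [ inj₁ , inj₂ ∘ inj₁ ]′ (share-or-confined L A∪B≥ C∪D≥ AB≥1)
  ...   | no _ | yes CD≥1 = [ inj₁ ∘ rotate , inj₂ ∘ inj₁ ∘ Z-rotate {C} {D} {A} {B} ]′
          (share-or-confined (lists-rotate L) C∪D≥ A∪B≥ CD≥1)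
  ...   | no AB≱1 | no CD≱1 = inj₂ (inj₂ (n<1⇒n≡0 (≰⇒> AB≱1) , n<1⇒n≡0 (≰⇒> CD≱1)))

  -- A colour of `A ∩ B` is in neither `C` nor `D`. Hence |C| + |D| + |A ∩ B| counts each colour of
  -- `Z` at most once, apart from a second count on `C ∩ D`.
  share-bound : Lists A B C D → card (Z A B C D) ≤ k + k → card (A ∩ B) ≤ card (C ∩ D)
  share-bound {A} {B} {C} {D} L Z≤ = +-cancelˡ-≤ (k + k) _ _ (begin
    k + k + card (A ∩ B)
      ≤⟨ +-monoˡ-≤ (card (A ∩ B)) (+-mono-≤ (Lists.C≥ L) (Lists.D≥ L)) ⟩
    card C + card D + card (A ∩ B)
      ≡⟨ +-assoc (card C) (card D) _ ⟩
    card C + (card D + card (A ∩ B))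
      ≤⟨ cards-mono (C ∷ D ∷ A ∩ B ∷ []) (Z A B C D ∷ C ∩ D ∷ []) (λ σ →
           from-yes (∀𝔹⁶? λ u v a b c d → (𝟙 a + (𝟙 b + (𝟙 c + 𝟙 d)) ≤? 2) →-dec
             (𝟙 c + (𝟙 d + 𝟙 (a ∧ b)) ≤? 𝟙 (u ∨ (v ∨ (a ∨ (b ∨ (c ∨ d))))) + 𝟙 (c ∧ d)))
           (U₀ σ) (V₀ σ) (A σ) (B σ) (C σ) (D σ) (Lists.at-most-2 L σ)) ⟩
    card (Z A B C D) + card (C ∩ D)
      ≤⟨ +-monoˡ-≤ (card (C ∩ D)) Z≤ ⟩
    k + k + card (C ∩ D) ∎)
    where open ≤-Reasoning

  share-equal : Lists A B C D → card (Z A B C D) ≤ k + k → card (A ∩ B) ≡ card (C ∩ D)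
  share-equal {A} {B} {C} {D} L Z≤ =
    ≤-antisym (share-bound L Z≤) (share-bound (lists-rotate L) (Z-rotate {A} {B} {C} {D} Z≤))

  -- If two colours of the part cannot be shared in the pattern AB|CD, then
  -- A ∩ B and C ∩ D are both contained in U₀ or both contained in V₀.
  balanced : Lists A B C D → card (Z A B C D) ≤ k + k →
             Colours A B C D ⊎ card (U₀ ∩ A ∩ B) ≡ card (U₀ ∩ C ∩ D)
  balanced {A} {B} {C} {D} L Z≤ with 1 ≤? card (A ∩ B)
  ... | no AB≱1 = inj₂ (trans (none A B (n<1⇒n≡0 (≰⇒> AB≱1))) (sym (none C D
        (trans (sym (share-equal L Z≤)) (n<1⇒n≡0 (≰⇒> AB≱1))))))
    where
    none : ∀ P Q → card (P ∩ Q) ≡ 0 → card (U₀ ∩ P ∩ Q) ≡ 0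
    none P Q PQ≡0 = card-∅ (λ σ h → card≡0⇒∅ PQ≡0 σ (proj₂ (Equivalence.to (T-∧ {U₀ σ}) h)))
  ... | yes AB≥1 with 1 + k ≤? card (U₀ ∪ (A ∩ B) ∪ (C ∩ D)) | 1 + k ≤? card (V₀ ∪ (A ∩ B) ∪ (C ∩ D))
  ...   | yes U₀≥ | yes V₀≥ = inj₁ (share-two L AB≥1 (≤-trans AB≥1 (share-bound L Z≤)) U₀≥ V₀≥)
  ...   | no  U₀≱ | _ = inj₂ (trans (sym (all-of A B left)) (trans (share-equal L Z≤) (all-of C D right)))
    where
    all-of : ∀ P Q → card (U₀ ∪ (P ∩ Q)) ≤ k → card (P ∩ Q) ≡ card (U₀ ∩ P ∩ Q)
    all-of P Q ≤k = ≤-antisym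
      (+-cancelˡ-≤ k _ _ (≤-trans (+-monoˡ-≤ (card (P ∩ Q)) (large 0F 0F))
        (≤-trans (card-∪-∩ U₀ (P ∩ Q)) (+-monoˡ-≤ _ ≤k))))
      (card-mono (λ σ → proj₂ ∘ Equivalence.to (T-∧ {U₀ σ})))
    left : card (U₀ ∪ (A ∩ B)) ≤ k
    left = ≤-trans (card-∪ˡ₃ U₀ (A ∩ B) (C ∩ D)) (s≤s⁻¹ (≰⇒> U₀≱))
    right : card (U₀ ∪ (C ∩ D)) ≤ k
    right = ≤-trans (card-mono (λ σ → from-yes
      (∀𝔹³? λ u p q → T? (u ∨ q) →-dec T? (u ∨ (p ∨ q))) (U₀ σ) ((A ∩ B) σ) ((C ∩ D) σ)))
      (s≤s⁻¹ (≰⇒> U₀≱))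
  ...   | yes _   | no V₀≱ = inj₂ (trans (none-of A B left) (sym (none-of C D right)))
    where
    none-of : ∀ P Q → card (V₀ ∪ (P ∩ Q)) ≤ k → card (U₀ ∩ P ∩ Q) ≡ 0
    none-of P Q ≤k = n≤0⇒n≡0 (+-cancelʳ-≤ (card (P ∩ Q)) _ _ (≤-trans
      (+-monoʳ-≤ (card (U₀ ∩ P ∩ Q))
        (+-cancelˡ-≤ k _ (card (V₀ ∩ P ∩ Q)) (≤-trans (+-monoˡ-≤ (card (P ∩ Q)) (large 0F 1F))
          (≤-trans (card-∪-∩ V₀ (P ∩ Q)) (+-monoˡ-≤ _ ≤k)))))
      (cards-mono (U₀ ∩ P ∩ Q ∷ V₀ ∩ P ∩ Q ∷ []) (P ∩ Q ∷ []) (λ σ → from-yes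
        (∀𝔹³? λ u v x → ¬? (T? (u ∧ v)) →-dec (𝟙 (u ∧ x) + 𝟙 (v ∧ x) ≤? 𝟙 x))
        (U₀ σ) (V₀ σ) ((P ∩ Q) σ) (disjoint 0F σ)))))
    left : card (V₀ ∪ (A ∩ B)) ≤ k
    left = ≤-trans (card-∪ˡ₃ V₀ (A ∩ B) (C ∩ D)) (s≤s⁻¹ (≰⇒> V₀≱))
    right : card (V₀ ∪ (C ∩ D)) ≤ k
    right = ≤-trans (card-mono (λ σ → from-yes
      (∀𝔹³? λ u p q → T? (u ∨ q) →-dec T? (u ∨ (p ∨ q))) (V₀ σ) ((A ∩ B) σ) ((C ∩ D) σ)))
      (s≤s⁻¹ (≰⇒> V₀≱))

  -- At most 2k colours, each in at most two lists, give the four lists a total size of at most 4k,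
  -- so none can exceed k. If no pattern allows sharing on both halves, `balanced` holds for all
  -- three and makes k even.
  confined : Lists A B C D → card (Z A B C D) ≤ k + k →
             2 ∤ k ⊎ ∃[ j ] 1 + k ≤ card ((A ◂ B ◂ C ◂ D ◂ ⟨⟩) j) → Colours A B C D
  confined {A} {B} {C} {D} L Z≤ extra = case extra of λ where
      (inj₂ (j , ≥1+k)) → contradiction (≤-trans (surplus j ≥1+k) total≤) (<-irrefl refl)
      (inj₁ k-odd) → case balanced L Z≤ , balanced (lists-swap₁₂ L) Z₁₂≤
                        , balanced (lists-swap₁₃ L) Z₁₃≤ of λ where
        (inj₁ C , _ , _) → C
        (inj₂ _ , inj₁ C , _) → swap₁₂ C
        (inj₂ _ , inj₂ _ , inj₁ C) → swap₁₃ C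
        (inj₂ e₁ , inj₂ e₂ , inj₂ e₃) → contradiction
          (divides (card (U₀ ∩ A ∩ B) + card (U₀ ∩ A ∩ C) + card (U₀ ∩ A ∩ D)) (even e₁ e₂ e₃)) k-odd
    where
    open ≤-Reasoning
    open Lists L
    Z₁₂≤ : card (Z A C B D) ≤ k + k
    Z₁₂≤ = Z-permute {A} {C} {B} {D} {A} {B} {C} {D} (λ σ → from-yes
      (∀𝔹⁴? λ a b c d → T? (a ∨ (c ∨ (b ∨ d))) →-dec T? (a ∨ (b ∨ (c ∨ d))))
      (A σ) (B σ) (C σ) (D σ)) Z≤
    Z₁₃≤ : card (Z A D C B) ≤ k + k
    Z₁₃≤ = Z-permute {A} {D} {C} {B} {A} {B} {C} {D} (λ σ → from-yes
      (∀𝔹⁴? λ a b c d → T? (a ∨ (d ∨ (c ∨ b))) →-dec T? (a ∨ (b ∨ (c ∨ d))))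
      (A σ) (B σ) (C σ) (D σ)) Z≤

    total≤ : card A + (card B + (card C + card D)) ≤ k + k + (k + k)
    total≤ = ≤-trans (cards-mono (A ∷ B ∷ C ∷ D ∷ []) (Z A B C D ∷ Z A B C D ∷ []) (λ σ → from-yes
      (∀𝔹⁶? λ u v a b c d → (𝟙 a + (𝟙 b + (𝟙 c + 𝟙 d)) ≤? 2) →-dec
        (𝟙 a + (𝟙 b + (𝟙 c + 𝟙 d)) ≤?
          𝟙 (u ∨ (v ∨ (a ∨ (b ∨ (c ∨ d))))) + 𝟙 (u ∨ (v ∨ (a ∨ (b ∨ (c ∨ d)))))))
      (U₀ σ) (V₀ σ) (A σ) (B σ) (C σ) (D σ) (at-most-2 σ))) (+-mono-≤ Z≤ Z≤)

    surplus : ∀ j → 1 + k ≤ card ((A ◂ B ◂ C ◂ D ◂ ⟨⟩) j) →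
              1 + (k + k + (k + k)) ≤ card A + (card B + (card C + card D))
    surplus j h = ≤-trans (≤-reflexive (one j))
      (+-mono-≤ (≥ 0F) (+-mono-≤ (≥ 1F) (+-mono-≤ (≥ 2F) (≥ 3F))))
      where
      sums : ∀ p q r s k → p + (q + (r + s)) + (k + k + (k + k)) ≡
                           (p + k) + ((q + k) + ((r + k) + (s + k)))
      sums = solve-∀
      one : ∀ j → 1 + (k + k + (k + k)) ≡
                  𝟙 (⁅ j ⁆ 0F) + k + (𝟙 (⁅ j ⁆ 1F) + k + (𝟙 (⁅ j ⁆ 2F) + k + (𝟙 (⁅ j ⁆ 3F) + k)))
      one 0F = sums 1 0 0 0 k
      one 1F = sums 0 1 0 0 k
      one 2F = sums 0 0 1 0 k
      one 3F = sums 0 0 0 1 k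
      all≥ : ∀ i → k ≤ card ((A ◂ B ◂ C ◂ D ◂ ⟨⟩) i)
      all≥ 0F = A≥
      all≥ 1F = B≥
      all≥ 2F = C≥
      all≥ 3F = D≥
      ≥ : ∀ i → 𝟙 (⁅ j ⁆ i) + k ≤ card ((A ◂ B ◂ C ◂ D ◂ ⟨⟩) i)
      ≥ i with i ≟ᶠ j
      ... | yes refl = h
      ... | no  _    = all≥ i

    -- All the counts are tight: every colour of `Z` lies in exactly two of the four lists, and `U₀`
    -- has exactly k colours. So the six pairwise intersections partition `U₀`, and by hypothesis
    -- they come in three couples of equal size.
    even : card (U₀ ∩ A ∩ B) ≡ card (U₀ ∩ C ∩ D) → card (U₀ ∩ A ∩ C) ≡ card (U₀ ∩ B ∩ D) →
           card (U₀ ∩ A ∩ D) ≡ card (U₀ ∩ C ∩ B) →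
           k ≡ (card (U₀ ∩ A ∩ B) + card (U₀ ∩ A ∩ C) + card (U₀ ∩ A ∩ D)) * 2
    even e₁ e₂ e₃ = trans (≤-antisym k≤Σ Σ≤k) (double e₁ e₂ e₃)
      where
      pairs : List (FinSet c)
      pairs = U₀ ∩ A ∩ B ∷ U₀ ∩ C ∩ D ∷ U₀ ∩ A ∩ C ∷ U₀ ∩ B ∩ D ∷
              U₀ ∩ A ∩ D ∷ U₀ ∩ C ∩ B ∷ []

      double : ∀ {p p′ q q′ r r′} → p ≡ p′ → q ≡ q′ → r ≡ r′ →
               p + (p′ + (q + (q′ + (r + r′)))) ≡ (p + q + r) * 2
      double {p} {_} {q} {_} {r} refl refl refl = twice p q r
        where
        twice : ∀ p q r → p + (p + (q + (q + (r + r)))) ≡ (p + q + r) * 2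
        twice = solve-∀

      k≤Σ : k ≤ cards pairs
      k≤Σ = +-cancelʳ-≤ (k + k + (k + k)) _ _ (begin
        k + (k + k + (k + k))
          ≤⟨ +-mono-≤ (large 0F 0F) (≤-trans (≤-reflexive (+-assoc k k (k + k)))
               (+-mono-≤ A≥ (+-mono-≤ B≥ (+-mono-≤ C≥ D≥)))) ⟩
        card U₀ + (card A + (card B + (card C + card D)))
          -- Two copies of `Z` pay for every colour except one of `U₀` that lies in two lists; that
          -- colour belongs to one member of `pairs`.
          ≤⟨ cards-mono (U₀ ∷ A ∷ B ∷ C ∷ D ∷ [])
               (Z A B C D ∷ Z A B C D ∷ pairs) (λ σ → from-yes
               (∀𝔹⁶? λ u v a b c d → (𝟙 a + (𝟙 b + (𝟙 c + 𝟙 d)) ≤? 2) →-dec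
                 (𝟙 u + (𝟙 a + (𝟙 b + (𝟙 c + 𝟙 d))) ≤?
                  𝟙 (u ∨ (v ∨ (a ∨ (b ∨ (c ∨ d))))) + (𝟙 (u ∨ (v ∨ (a ∨ (b ∨ (c ∨ d))))) +
                  (𝟙 (u ∧ (a ∧ b)) + (𝟙 (u ∧ (c ∧ d)) + (𝟙 (u ∧ (a ∧ c)) + (𝟙 (u ∧ (b ∧ d)) +
                  (𝟙 (u ∧ (a ∧ d)) + 𝟙 (u ∧ (c ∧ b))))))))))
               (U₀ σ) (V₀ σ) (A σ) (B σ) (C σ) (D σ) (at-most-2 σ)) ⟩
        card (Z A B C D) + (card (Z A B C D) + cards pairs)
          ≤⟨ +-mono-≤ Z≤ (+-monoˡ-≤ (cards pairs) Z≤) ⟩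
        k + k + (k + k + cards pairs)
          ≡⟨ shuffle k (cards pairs) ⟩
        cards pairs + (k + k + (k + k)) ∎)
        where
        shuffle : ∀ k s → k + k + (k + k + s) ≡ s + (k + k + (k + k))
        shuffle = solve-∀

      Σ≤k : cards pairs ≤ k
      Σ≤k = +-cancelʳ-≤ k _ _ (begin
        cards pairs + k
          ≤⟨ +-mono-≤ (cards-mono pairs (U₀ ∷ []) (λ σ → from-yes
               (∀𝔹⁵? λ u a b c d → (𝟙 a + (𝟙 b + (𝟙 c + 𝟙 d)) ≤? 2) →-dec
                 (𝟙 (u ∧ (a ∧ b)) + (𝟙 (u ∧ (c ∧ d)) + (𝟙 (u ∧ (a ∧ c)) + (𝟙 (u ∧ (b ∧ d)) +
                  (𝟙 (u ∧ (a ∧ d)) + 𝟙 (u ∧ (c ∧ b)))))) ≤? 𝟙 u))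
               (U₀ σ) (A σ) (B σ) (C σ) (D σ) (at-most-2 σ))) (large 0F 1F) ⟩
        card U₀ + card V₀
          ≤⟨ card-disjoint U₀ V₀ (disjoint 0F) ⟩
        card (U₀ ∪ V₀)
          ≤⟨ card-∪ˡ₃ U₀ V₀ (A ∪ B ∪ C ∪ D) ⟩
        card (Z A B C D)
          ≤⟨ Z≤ ⟩
        k + k ∎)

  -- If no pattern yields a colouring or confinement, then all pairwise intersections are empty and
  -- the four vertices can be coloured from disjoint lists.
  at-most-two-colouring : Lists A B C D →
    2 ∤ k ⊎ ∃[ j ] 1 + k ≤ card ((A ◂ B ◂ C ◂ D ◂ ⟨⟩) j) → Colours A B C D
  at-most-two-colouring {A} {B} {C} {D} L extra
    with pairing L | pairing (lists-swap₁₂ L) | pairing (lists-swap₁₃ L)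
  ... | inj₁ C | _ | _ = C
  ... | _ | inj₁ C | _ = swap₁₂ C
  ... | _ | _ | inj₁ C = swap₁₃ C
  ... | inj₂ (inj₁ Z≤) | _ | _ = confined L Z≤ extra
  ... | _ | inj₂ (inj₁ Z≤) | _ = confined L (Z-permute {A} {B} {C} {D} {A} {C} {B} {D} (λ σ → from-yes
      (∀𝔹⁴? λ a b c d → T? (a ∨ (b ∨ (c ∨ d))) →-dec T? (a ∨ (c ∨ (b ∨ d))))
      (A σ) (B σ) (C σ) (D σ)) Z≤) extra
  ... | _ | _ | inj₂ (inj₁ Z≤) = confined L (Z-permute {A} {B} {C} {D} {A} {D} {C} {B} (λ σ → from-yes
      (∀𝔹⁴? λ a b c d → T? (a ∨ (b ∨ (c ∨ d))) →-dec T? (a ∨ (d ∨ (c ∨ b))))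
      (A σ) (B σ) (C σ) (D σ)) Z≤) extra
  ... | inj₂ (inj₂ (AB , CD)) | inj₂ (inj₂ (AC , BD)) | inj₂ (inj₂ (AD , CB)) =
    four-classes A B C D (card≡0⇒∅ AB) (card≡0⇒∅ AC) (card≡0⇒∅ AD)
      (λ σ → card≡0⇒∅ CB σ ∘ from-yes (∀𝔹²? λ b c → T? (b ∧ c) →-dec T? (c ∧ b)) (B σ) (C σ))
      (card≡0⇒∅ BD) (card≡0⇒∅ CD) A≥ B≥ C≥ D≥
    where open Lists L

  -- No colour is in all four lists, so a colour in three of them meets the hypothesis of `triple`.
  -- Without such a colour every colour is in at most two lists.
  four-and-disjoint-pairs : ∀ A B C D → k ≤ card A → k ≤ card B → k ≤ card C → k ≤ card D →
    Disjoint (A ∩ B ∩ C) D → 2 ∤ k ⊎ ∃[ j ] 1 + k ≤ card ((A ◂ B ◂ C ◂ D ◂ ⟨⟩) j) → Colours A B C D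
  four-and-disjoint-pairs A B C D A≥ B≥ C≥ D≥ none extra
    with 1 ≤? card (A ∩ B ∩ C) | 1 ≤? card (A ∩ B ∩ D) | 1 ≤? card (A ∩ C ∩ D) | 1 ≤? card (B ∩ C ∩ D)
  ... | yes ABC≥1 | _ | _ | _ = triple none ABC≥1 D≥
  ... | _ | yes ABD≥1 | _ | _ = swap₂₃ (triple (λ σ → none σ ∘ from-yes
      (∀𝔹⁴? λ a b c d → T? ((a ∧ (b ∧ d)) ∧ c) →-dec T? ((a ∧ (b ∧ c)) ∧ d))
      (A σ) (B σ) (C σ) (D σ)) ABD≥1 C≥)
  ... | _ | _ | yes ACD≥1 | _ = swap₁₂ (swap₂₃ (triple (λ σ → none σ ∘ from-yes
      (∀𝔹⁴? λ a b c d → T? ((a ∧ (c ∧ d)) ∧ b) →-dec T? ((a ∧ (b ∧ c)) ∧ d))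
      (A σ) (B σ) (C σ) (D σ)) ACD≥1 B≥))
  ... | _ | _ | _ | yes BCD≥1 = merge (3F ◂ 0F ◂ 1F ◂ 2F ◂ ⟨⟩)
      (λ { 0F _ h → h ; 1F _ h → h ; 2F _ h → h ; 3F _ h → h })
      (triple (λ σ → none σ ∘ from-yes
      (∀𝔹⁴? λ a b c d → T? ((b ∧ (c ∧ d)) ∧ a) →-dec T? ((a ∧ (b ∧ c)) ∧ d))
      (A σ) (B σ) (C σ) (D σ)) BCD≥1 A≥)
  ... | no ¬ABC | no ¬ABD | no ¬ACD | no ¬BCD = at-most-two-colouring (record
      { at-most-2 = λ σ → from-yes
          (∀𝔹⁴? λ a b c d → ¬? (T? (a ∧ (b ∧ c))) →-dec (¬? (T? (a ∧ (b ∧ d))) →-dec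
            (¬? (T? (a ∧ (c ∧ d))) →-dec (¬? (T? (b ∧ (c ∧ d))) →-dec (𝟙 a + (𝟙 b + (𝟙 c + 𝟙 d)) ≤? 2)))))
          (A σ) (B σ) (C σ) (D σ) (empty ¬ABC σ) (empty ¬ABD σ) (empty ¬ACD σ) (empty ¬BCD σ)
      ; A≥ = A≥ ; B≥ = B≥ ; C≥ = C≥ ; D≥ = D≥ }) extra
    where
    empty : ∀ {P : FinSet c} → ¬ (1 ≤ card P) → ∀ σ → ¬ T (P σ)
    empty ¬P = card≡0⇒∅ (n<1⇒n≡0 (≰⇒> ¬P))

-- Induction on the number of parts

-- Both vertices of the pair `i` take `σ`, and all other vertices avoid it.
remove-pair : {X : Fin r → FinSet c} {Y : Fin (suc m) → Fin 2 → FinSet c} (i : Fin (suc m)) (σ : Fin c) →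
              T (Y i 0F σ) → T (Y i 1F σ) →
              Colouring (λ j → X j ─ σ) (λ i′ s → Y (punchIn i i′) s ─ σ) → Colouring X Y
remove-pair {r} {c} {m} {X} {Y} i σ σ∈U σ∈V C = record
  { x = x ; y = y′ ; x∈ = λ j → proj₁ (∈-─⁻ (X j) (x∈ j)) ; y∈ = y′∈ ; x≢y = x≢y′ ; y-sep = y′-sep }
  where
  open Colouring C

  y′ : Fin (suc m) → Fin 2 → Fin c
  y′ i′ s with i ≟ᶠ i′
  ... | yes _   = σ
  ... | no i≢i′ = y (punchOut i≢i′) s

  y∈─ : ∀ i′ s (i≢i′ : i ≢ i′) → T (Y i′ s (y (punchOut i≢i′) s)) × y (punchOut i≢i′) s ≢ σ
  y∈─ i′ s i≢i′ = subst (λ l → T (Y l s (y (punchOut i≢i′) s)) × y (punchOut i≢i′) s ≢ σ)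
    (punchIn-punchOut i≢i′) (∈-─⁻ (Y (punchIn i (punchOut i≢i′)) s) (y∈ (punchOut i≢i′) s))

  y′∈ : ∀ i′ s → T (Y i′ s (y′ i′ s))
  y′∈ i′ s with i ≟ᶠ i′
  y′∈ i′ 0F | yes refl = σ∈U
  y′∈ i′ 1F | yes refl = σ∈V
  ... | no i≢i′ = proj₁ (y∈─ i′ s i≢i′)

  x≢y′ : ∀ j i′ s → x j ≢ y′ i′ s
  x≢y′ j i′ s with i ≟ᶠ i′
  ... | yes _   = proj₂ (∈-─⁻ (X j) (x∈ j))
  ... | no i≢i′ = x≢y j (punchOut i≢i′) s

  y′-sep : ∀ a s b t → y′ a s ≡ y′ b t → a ≡ b
  y′-sep a s b t eq with i ≟ᶠ a | i ≟ᶠ b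
  ... | yes refl | yes refl = refl
  ... | yes refl | no i≢b   = contradiction (sym eq) (proj₂ (y∈─ b t i≢b))
  ... | no i≢a   | yes refl = contradiction eq (proj₂ (y∈─ a s i≢a))
  ... | no i≢a   | no i≢b   = punchOut-injective i≢a i≢b (y-sep _ s _ t eq)

─-large : ∀ {k} (p : FinSet n) (σ : Fin n) → suc k ≤ card p → k ≤ card (p ─ σ)
─-large p σ p≥ = s≤s⁻¹ (≤-trans p≥ (card-─ p σ))

common? : (Y : Fin m → Fin 2 → FinSet c) →
          Dec (∃[ i ] ∃[ σ ] T (Y i 0F σ ∧ Y i 1F σ))
common? Y = any? (λ i → any? (λ σ → T? (Y i 0F σ ∧ Y i 1F σ)))

-- Erdős, Rubin and Taylor: K(2,…,2) is chromatic-choosable.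
pairs-colouring : ∀ m (Y : Fin m → Fin 2 → FinSet c) → (∀ i s → m ≤ card (Y i s)) →
                  Colouring {r = 0} (λ ()) Y
pairs-colouring m Y large with common? Y
... | no none = disjoint-pairs-colouring Y (λ i σ σ∈ → none (i , σ , σ∈)) large
pairs-colouring (suc m) Y large | yes (i , σ , σ∈)
  with σ∈U , σ∈V ← Equivalence.to (T-∧ {Y i 0F σ}) σ∈ =
  remove-pair i σ σ∈U σ∈V (merge (λ ()) (λ ())
    (pairs-colouring m _ (λ i′ s → ─-large (Y (punchIn i i′) s) σ (large (punchIn i i′) s))))

constant-colouring : {X : Fin r → FinSet c} {Y : Fin m → Fin 2 → FinSet c} (σ : Fin c) →
  (∀ j → T (X j σ)) → Colouring {r = 0} (λ ()) (λ i s → Y i s ─ σ) → Colouring X Y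
constant-colouring {Y = Y} σ σ∈X C = record
  { x = λ _ → σ ; y = y ; x∈ = σ∈X ; y∈ = λ i s → proj₁ (∈-─⁻ (Y i s) (y∈ i s))
  ; x≢y = λ _ i s eq → proj₂ (∈-─⁻ (Y i s) (y∈ i s)) (sym eq) ; y-sep = y-sep }
  where open Colouring C

-- For even 1 + m one list has to be longer: see BadLists.
four-and-pairs-colouring : ∀ m (X : Fin 4 → FinSet c) (Y : Fin m → Fin 2 → FinSet c) →
  (∀ j → suc m ≤ card (X j)) → (∀ i s → suc m ≤ card (Y i s)) →
  2 ∤ suc m ⊎ ∃[ j ] 2 + m ≤ card (X j) → Colouring X Y
four-and-pairs-colouring zero X Y X≥ _ _ = record
  { x = λ j → proj₁ (card-nonempty {p = X j} (X≥ j)) ; y = λ ()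
  ; x∈ = λ j → proj₂ (card-nonempty {p = X j} (X≥ j))
  ; y∈ = λ () ; x≢y = λ _ () ; y-sep = λ () }
four-and-pairs-colouring (suc m) X Y X≥ Y≥ extra with any? (λ σ → all? (λ j → T? (X j σ))) | common? Y
... | yes (σ , σ∈X) | _ = constant-colouring σ σ∈X
      (pairs-colouring (suc m) _ (λ i s → ─-large (Y i s) σ (Y≥ i s)))
... | no ∄σ | yes (i , σ , σ∈) = remove-pair i σ (proj₁ σ∈²) (proj₂ σ∈²)
      (four-and-pairs-colouring m _ _ (λ j → ─-large (X j) σ (X≥ j))
        (λ i′ s → ─-large (Y (punchIn i i′) s) σ (Y≥ (punchIn i i′) s)) (extra′ (2 ∣? suc m)))
  where
  σ∈² = Equivalence.to (T-∧ {Y i 0F σ}) σ∈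
  -- No colour is common to the whole part, so `σ` misses some `X j`. That list keeps its `2 + m`
  -- colours, one more than the induction hypothesis asks of every list.
  extra′ : Dec (2 ∣ suc m) → 2 ∤ suc m ⊎ ∃[ j ] 2 + m ≤ card (X j ─ σ)
  extra′ (no odd) = inj₁ odd
  extra′ (yes _) with any? (λ j → ¬? (T? (X j σ)))
  ... | yes (j , σ∉X) = inj₂ (j , ≤-trans (X≥ j) (card-─-∉ (X j) σ∉X))
  ... | no  σ∈all     = contradiction
    (σ , λ j → decidable-stable (T? (X j σ)) (λ σ∉X → σ∈all (j , σ∉X))) ∄σ
-- `X` agrees only pointwise with the family of its four values, hence the merge along the identity.
... | no ∄σ | no none = merge (λ j → j) (λ { 0F _ h → h ; 1F _ h → h ; 2F _ h → h ; 3F _ h → h })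
  (four-and-disjoint-pairs (X 0F) (X 1F) (X 2F) (X 3F) (X≥ 0F) (X≥ 1F) (X≥ 2F) (X≥ 3F)
    (λ σ σ∈ → ∄σ (σ , everywhere σ σ∈))
    (map₂ (λ { (0F , h) → 0F , h ; (1F , h) → 1F , h ; (2F , h) → 2F , h ; (3F , h) → 3F , h }) extra))
  where
  open FourDisjointPairs Y (λ i σ σ∈ → none (i , σ , σ∈)) Y≥
  everywhere : ∀ σ → T ((X 0F σ ∧ (X 1F σ ∧ X 2F σ)) ∧ X 3F σ) → ∀ j → T (X j σ)
  everywhere σ σ∈ = λ { 0F → proj₁ each ; 1F → proj₁ (proj₂ each)
                      ; 2F → proj₁ (proj₂ (proj₂ each)) ; 3F → proj₂ (proj₂ (proj₂ each)) }
    where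
    each = from-yes
      (∀𝔹⁴? λ a b c d → T? ((a ∧ (b ∧ c)) ∧ d) →-dec (T? a ×-dec T? b ×-dec T? c ×-dec T? d))
      (X 0F σ) (X 1F σ) (X 2F σ) (X 3F σ) σ∈

-- The graph K(4,2,…,2)

∣∣≡card : (p : Subset n) → ∣ p ∣ ≡ card (lookup p)
∣∣≡card Vec.[]            = refl
∣∣≡card (inside  Vec.∷ p) = cong suc (∣∣≡card p)
∣∣≡card (outside Vec.∷ p) = ∣∣≡card p

T⇒∈ : {p : Subset n} {i : Fin n} → T (lookup p i) → i ∈ p
T⇒∈ {p = p} {i} t = lookup⇒[]= i p (Equivalence.to T-≡ t)

∈⇒T : {p : Subset n} {i : Fin n} → i ∈ p → T (lookup p i)
∈⇒T i∈p = Equivalence.from T-≡ ([]=⇒lookup i∈p)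

K4-2 : ∀ m → Graph (sum (4 ∷ replicate m 2))
K4-2 m = completeMultipartite (4 ∷ replicate m 2)

-- Coordinates for the vertices: `vertex` and `position` translate to and from the consecutive
-- blocks of `Fin`.
Position : ℕ → Set
Position m = Fin 4 ⊎ (Fin m × Fin 2)

pattern four j   = inj₁ j
pattern pair i s = inj₂ (i , s)

pairVertex : ∀ m → Fin m → Fin 2 → Fin (sum (replicate m 2))
pairVertex (suc m) zero    s = s ↑ˡ _
pairVertex (suc m) (suc i) s = 2 ↑ʳ pairVertex m i s

pairPosition : ∀ m → Fin (sum (replicate m 2)) → Fin m × Fin 2
pairPosition (suc m) v = [ (zero ,_) , map₁ suc ∘ pairPosition m ]′ (splitAt 2 v)

pairVertex-pairPosition : ∀ m v → let i , s = pairPosition m v in pairVertex m i s ≡ v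
pairVertex-pairPosition (suc m) v with splitAt 2 v in eq
... | inj₁ s = splitAt⁻¹-↑ˡ eq
... | inj₂ w = trans (cong (2 ↑ʳ_) (pairVertex-pairPosition m w)) (splitAt⁻¹-↑ʳ eq)

pairPosition-pairVertex : ∀ m i s → pairPosition m (pairVertex m i s) ≡ (i , s)
pairPosition-pairVertex (suc m) zero    s
  rewrite splitAt-↑ˡ 2 s (sum (replicate m 2)) = refl
pairPosition-pairVertex (suc m) (suc i) s
  rewrite pairPosition-pairVertex m i s = refl

vertex : ∀ m → Position m → Fin (sum (4 ∷ replicate m 2))
vertex m (four j)   = j ↑ˡ _
vertex m (pair i s) = 4 ↑ʳ pairVertex m i s

position : ∀ m → Fin (sum (4 ∷ replicate m 2)) → Position m
position m v = map₂ (pairPosition m) (splitAt 4 v)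

vertex-position : ∀ m v → vertex m (position m v) ≡ v
vertex-position m v with splitAt 4 v in eq
... | inj₁ j = splitAt⁻¹-↑ˡ eq
... | inj₂ w = trans (cong (4 ↑ʳ_) (pairVertex-pairPosition m w)) (splitAt⁻¹-↑ʳ eq)

position-vertex : ∀ m p → position m (vertex m p) ≡ p
position-vertex m (four j)   rewrite splitAt-↑ˡ 4 j (sum (replicate m 2)) = refl
position-vertex m (pair i s) = cong inj₂ (pairPosition-pairVertex m i s)

-- Valued in ℕ to avoid the index type `Fin (length (4 ∷ replicate m 2))` of `part`.
partIndex : Position m → ℕ
partIndex (four _)   = 0
partIndex (pair i _) = suc (toℕ i)

toℕ-part : ∀ m p → toℕ (part (4 ∷ replicate m 2) (vertex m p)) ≡ partIndex p
toℕ-part m (four j) rewrite splitAt-↑ˡ 4 j (sum (replicate m 2)) = refl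
toℕ-part m (pair i s) = cong suc (pairs m i s)
  where
  pairs : ∀ m i s → toℕ (part (replicate m 2) (pairVertex m i s)) ≡ toℕ i
  pairs (suc m) zero    s rewrite splitAt-↑ˡ 2 s (sum (replicate m 2)) = refl
  pairs (suc m) (suc i) s = cong suc (pairs m i s)

adjacent : ∀ {m} p q → partIndex p ≢ partIndex q → Graph.Adj (K4-2 m) (vertex m p) (vertex m q)
adjacent {m} p q p≢q part≡ = p≢q (trans (sym (toℕ-part m p)) (trans (cong toℕ part≡) (toℕ-part m q)))

adjacent⁻¹ : ∀ m {u v} → Graph.Adj (K4-2 m) u v → partIndex (position m u) ≢ partIndex (position m v)
adjacent⁻¹ m {u} {v} u~v eq = u~v (toℕ-injective (trans (sym (index u)) (trans eq (index v))))
  where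
  index : ∀ v → partIndex (position m v) ≡ toℕ (part (4 ∷ replicate m 2) v)
  index v = trans (sym (toℕ-part m (position m v)))
                  (cong (toℕ ∘ part (4 ∷ replicate m 2)) (vertex-position m v))

colouring⇒colorable : (L : ListAssignment (K4-2 m) c) →
  Colouring (λ j → lookup (L (vertex m (four j)))) (λ i s → lookup (L (vertex m (pair i s)))) →
  Colorable (K4-2 m) L
colouring⇒colorable {m} {c} L C = ψ ∘ position m , in-list , proper
  where
  open Colouring C
  ψ : Position m → Fin c
  ψ (four j)   = x j
  ψ (pair i s) = y i s

  ψ∈ : ∀ p → ψ p ∈ L (vertex m p)
  ψ∈ (four j)   = T⇒∈ (x∈ j)
  ψ∈ (pair i s) = T⇒∈ (y∈ i s)

  in-list : ∀ v → ψ (position m v) ∈ L v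
  in-list v = subst (λ w → ψ (position m v) ∈ L w) (vertex-position m v) (ψ∈ (position m v))

  separated : ∀ p q → partIndex p ≢ partIndex q → ψ p ≢ ψ q
  separated (four _)   (four _)   p≢q _  = p≢q refl
  separated (four j)   (pair i s) _   eq = x≢y j i s eq
  separated (pair i s) (four j)   _   eq = x≢y j i s (sym eq)
  separated (pair i s) (pair j t) p≢q eq = p≢q (cong (suc ∘ toℕ) (y-sep i s j t eq))

  proper : ∀ u v → Graph.Adj (K4-2 m) u v → ψ (position m u) ≢ ψ (position m v)
  proper u v u~v = separated (position m u) (position m v) (adjacent⁻¹ m {u} {v} u~v)

list-size : ∀ m {k} (L : ListAssignment (K4-2 m) c) → (∀ v → k ≤ ∣ L v ∣) →
            ∀ p → k ≤ card (lookup (L (vertex m p)))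
list-size m L L≥ p = ≤-trans (L≥ (vertex m p)) (≤-reflexive (∣∣≡card (L (vertex m p))))

odd⇒hallColorable : ∀ m → 2 ∤ suc m → HallColorable (K4-2 m) (suc m)
odd⇒hallColorable m odd c L _ L≥ = colouring⇒colorable L (four-and-pairs-colouring m _ _
  (λ j → list-size m L L≥ (four j)) (λ i s → list-size m L L≥ (pair i s)) (inj₁ odd))

-- With lists of size k + 1, any list on the part of size 4 is the longer one that
-- `four-and-pairs-colouring` asks for.
hallColorable-suc : ∀ m → HallColorable (K4-2 m) (2 + m)
hallColorable-suc m c L _ L≥ = colouring⇒colorable L (four-and-pairs-colouring m _ _
  (λ j → <⇒≤ (list-size m L L≥ (four j))) (λ i s → <⇒≤ (list-size m L L≥ (pair i s)))
  (inj₂ (0F , list-size m L L≥ (four 0F))))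

-- Lower bound

∑-bounded : ∀ {a} (f : Fin n → ℕ) → (∀ i → f i ≤ a) → ∑[ i < n ] f i ≤ n * a
∑-bounded {zero}  f f≤a = z≤n
∑-bounded {suc n} f f≤a = +-mono-≤ (f≤a zero) (∑-bounded (f ∘ suc) (f≤a ∘ suc))

-- If the support of every colour is properly d-coloured by g, some class of g
-- is an independent set with at least 1/d of the vertices of H carrying σ.
d-colourable-supports⇒hall : ∀ {d} .{{_ : NonZero d}} (G : Graph n) (L : ListAssignment G c)
  (g : Fin n → Fin d) →
  (∀ σ {u v} → Graph.Adj G u v → T (lookup (L u) σ) → T (lookup (L v) σ) → g u ≢ g v) →
  (∀ v → d ≤ ∣ L v ∣) → HallCondition G L
d-colourable-supports⇒hall {n} {c} {d} G L g proper large H = *-cancelˡ-≤ d (begin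
  d * ∣ verts ∣
    ≡⟨ cong (d *_) (trans (∣∣≡card verts) (card≡∑ (lookup verts))) ⟩
  d * ∑[ v < n ] 𝟙 (lookup verts v)
    ≡⟨ *-distribˡ-sum d (λ v → 𝟙 (lookup verts v)) ⟩
  ∑[ v < n ] (d * 𝟙 (lookup verts v))
    ≤⟨ ∑-mono-≤ per-vertex ⟩
  ∑[ v < n ] ∑[ σ < c ] 𝟙 (carries v σ)
    ≡⟨ ∑-comm (λ v σ → 𝟙 (carries v σ)) ⟩
  ∑[ σ < c ] ∑[ v < n ] 𝟙 (carries v σ)
    ≤⟨ ∑-mono-≤ per-colour ⟩
  ∑[ σ < c ] (d * α (H-induced σ))
    ≡⟨ *-distribˡ-sum d (λ σ → α (H-induced σ)) ⟨
  d * ∑[ σ < c ] α (H-induced σ) ∎)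
  where
  open ≤-Reasoning
  open Subgraph H using (verts)

  H-induced : Fin c → Subgraph G
  H-induced σ = induce H (support G L σ)

  carries : Fin n → Fin c → Bool
  carries v σ = lookup verts v ∧ lookup (L v) σ

  class : Fin c → Fin d → FinSet n
  class σ t v = carries v σ ∧ ⁅ g v ⁆ t

  per-vertex : ∀ v → d * 𝟙 (lookup verts v) ≤ ∑[ σ < c ] 𝟙 (carries v σ)
  per-vertex v with lookup verts v
  ... | false = ≤-trans (≤-reflexive (*-zeroʳ d)) z≤n
  ... | true  = begin
    d * 1                             ≡⟨ *-identityʳ d ⟩
    d                                 ≤⟨ large v ⟩
    ∣ L v ∣                           ≡⟨ ∣∣≡card (L v) ⟩
    card (lookup (L v))               ≡⟨ card≡∑ (lookup (L v)) ⟩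
    ∑[ σ < c ] 𝟙 (lookup (L v) σ)     ∎

  independent : ∀ σ t → Independent (H-induced σ) (tabulate (class σ t))
  independent σ t =
    (λ {v} v∈ → x∈p∩q⁺ (T⇒∈ (proj₁ (carrier v v∈)) ,
      T⇒∈ (subst T (sym (lookup∘tabulate _ v)) (proj₁ (proj₂ (carrier v v∈)))))) ,
    (λ u u∈ v v∈ (u~v , _) → proper σ (Subgraph.edge H u~v)
      (proj₁ (proj₂ (carrier u u∈))) (proj₁ (proj₂ (carrier v v∈)))
      (trans (sym (proj₂ (proj₂ (carrier u u∈)))) (proj₂ (proj₂ (carrier v v∈)))))
    where
    carrier : ∀ v → v ∈ tabulate (class σ t) → T (lookup verts v) × T (lookup (L v) σ) × t ≡ g v
    carrier v v∈ with v∈σ , t≡ ← Equivalence.to (T-∧ {carries v σ})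
                                   (subst T (lookup∘tabulate (class σ t) v) (∈⇒T v∈)) =
      proj₁ (Equivalence.to (T-∧ {lookup verts v}) v∈σ) ,
      proj₂ (Equivalence.to (T-∧ {lookup verts v}) v∈σ) , toWitness t≡

  class≤α : ∀ σ t → card (class σ t) ≤ α (H-induced σ)
  class≤α σ t = begin
    card (class σ t)                        ≡⟨ card-cong (λ v → lookup∘tabulate (class σ t) v) ⟨
    card (lookup (tabulate (class σ t)))    ≡⟨ ∣∣≡card (tabulate (class σ t)) ⟨
    ∣ tabulate (class σ t) ∣                ≤⟨ α-upper (H-induced σ) (independent σ t) ⟩
    α (H-induced σ)                         ∎

  one-class : ∀ b (w : Fin d) → 𝟙 b ≤ ∑[ t < d ] 𝟙 (b ∧ ⁅ w ⁆ t)
  one-class false w = z≤n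
  one-class true  w = ≤-reflexive (trans (sym (card-⁅⁆ w)) (card≡∑ ⁅ w ⁆))

  per-colour : ∀ σ → ∑[ v < n ] 𝟙 (carries v σ) ≤ d * α (H-induced σ)
  per-colour σ = begin
    ∑[ v < n ] 𝟙 (carries v σ)
      ≤⟨ ∑-mono-≤ (λ v → one-class (carries v σ) (g v)) ⟩
    ∑[ v < n ] ∑[ t < d ] 𝟙 (class σ t v)
      ≡⟨ ∑-comm (λ v t → 𝟙 (class σ t v)) ⟩
    ∑[ t < d ] ∑[ v < n ] 𝟙 (class σ t v)
      ≤⟨ ∑-bounded _ (λ t → ≤-trans (≤-reflexive (sym (card≡∑ (class σ t)))) (class≤α σ t)) ⟩
    d * α (H-induced σ) ∎

card-blocks : ∀ n h (β : FinSet n) → card (λ (σ : Fin (n * h)) → β (proj₁ (remQuot h σ))) ≡ card β * h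
card-blocks zero    h β = refl
card-blocks (suc n) h β = begin
  card (λ σ → β (proj₁ (remQuot {suc n} h σ)))
    ≡⟨ card-+ h (λ σ → β (proj₁ (remQuot {suc n} h σ))) ⟩
  card (λ i → β (proj₁ (remQuot {suc n} h (i ↑ˡ (n * h))))) +
    card (λ i → β (proj₁ (remQuot {suc n} h (h ↑ʳ i))))
    ≡⟨ cong₂ _+_ (card-cong first) (card-cong later) ⟩
  card {h} (λ _ → β zero) + card (λ i → β (suc (proj₁ (remQuot {n} h i))))
    ≡⟨ cong₂ _+_ (constant (β zero)) (card-blocks n h (β ∘ suc)) ⟩
  𝟙 (β zero) * h + card (β ∘ suc) * h
    ≡⟨ *-distribʳ-+ h (𝟙 (β zero)) (card (β ∘ suc)) ⟨
  card β * h ∎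
  where
  open ≡-Reasoning
  first : ∀ i → β (proj₁ (remQuot {suc n} h (i ↑ˡ (n * h)))) ≡ β zero
  first i rewrite splitAt-↑ˡ h i (n * h) = refl
  later : ∀ i → β (proj₁ (remQuot {suc n} h (h ↑ʳ i))) ≡ β (suc (proj₁ (remQuot {n} h i)))
  later i rewrite splitAt-↑ʳ h (n * h) i = refl
  constant : ∀ b → card {h} (λ _ → b) ≡ 𝟙 b * h
  constant true  = trans card-full (sym (+-identityʳ h))
  constant false = card-∅ {h} (λ _ ())

-- Colours come in six blocks of size h; lists are unions of two blocks, given
-- for K(4,2,…,2) with an even number 2h of parts. A further pair, present
-- if there are 2h + 1 parts, gets blocks of its own.
module BadLists (h′ m : ℕ) (2h≤1+m : 2 * suc h′ ≤ suc m) (m≤2h : m ≤ 2 * suc h′) where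

  h = suc h′
  d = 2 * h

  -- The sides {0F, 1F} and {2F, 3F} are the two lists of each core pair; the part of size 4 has the
  -- four choices of one block from each side.
  blocks : Position m → FinSet 6
  blocks (four 0F) = ⁅ 0F ⁆ ∪ ⁅ 2F ⁆
  blocks (four 1F) = ⁅ 0F ⁆ ∪ ⁅ 3F ⁆
  blocks (four 2F) = ⁅ 1F ⁆ ∪ ⁅ 2F ⁆
  blocks (four 3F) = ⁅ 1F ⁆ ∪ ⁅ 3F ⁆
  -- As `m ≤ d`, the test fails only for a pair with part index exactly `d`, the last one when there
  -- are 2h + 1 parts.
  blocks (pair i s) with suc (toℕ i) <? d
  blocks (pair i 0F) | yes _ = ⁅ 0F ⁆ ∪ ⁅ 1F ⁆
  blocks (pair i 1F) | yes _ = ⁅ 2F ⁆ ∪ ⁅ 3F ⁆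
  ... | no _ = ⁅ 4F ⁆ ∪ ⁅ 5F ⁆

  block : Fin (6 * h) → Fin 6
  block σ = proj₁ (remQuot {6} h σ)

  lists : ListAssignment (K4-2 m) (6 * h)
  lists v = tabulate (λ σ → blocks (position m v) (block σ))

  lookup-lists : ∀ v σ → T (lookup (lists v) σ) → T (blocks (position m v) (block σ))
  lookup-lists v σ = subst T (lookup∘tabulate (λ σ → blocks (position m v) (block σ)) σ)

  two-blocks : ∀ p → card (blocks p) ≡ 2
  two-blocks (four 0F) = refl
  two-blocks (four 1F) = refl
  two-blocks (four 2F) = refl
  two-blocks (four 3F) = refl
  two-blocks (pair i s) with suc (toℕ i) <? d
  two-blocks (pair i 0F) | yes _ = refl
  two-blocks (pair i 1F) | yes _ = refl
  ... | no _ = refl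

  ∣lists∣ : ∀ v → ∣ lists v ∣ ≡ d
  ∣lists∣ v = begin
    ∣ lists v ∣
      ≡⟨ ∣∣≡card (lists v) ⟩
    card (lookup (lists v))
      ≡⟨ card-cong (lookup∘tabulate (λ σ → blocks (position m v) (block σ))) ⟩
    card (λ σ → blocks (position m v) (block σ))
      ≡⟨ card-blocks 6 h (blocks (position m v)) ⟩
    card (blocks (position m v)) * h
      ≡⟨ cong (_* h) (two-blocks (position m v)) ⟩
    d ∎
    where open ≡-Reasoning

  colour : Position m → Fin d
  colour p with partIndex p <? d
  ... | yes p<d = fromℕ< p<d
  -- The extra pair may repeat a colour of the core, because no block lies both in its lists and in
  -- a core list.
  ... | no  _   = zero

  data Kind (p : Position m) : Set where
    core  : partIndex p < d → (∀ b → T (blocks p b) → toℕ b < 4) → Kind p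
    extra : partIndex p ≡ d → (∀ b → T (blocks p b) → 4 ≤ toℕ b) → Kind p

  kind : ∀ p → Kind p
  kind (four j) = core (s≤s z≤n) (four-blocks j)
    where
    four-blocks : ∀ j b → T (blocks (four j) b) → toℕ b < 4
    four-blocks 0F = from-yes (all? {n = 6} λ b → T? ((⁅ 0F ⁆ ∪ ⁅ 2F ⁆) b) →-dec (toℕ b <? 4))
    four-blocks 1F = from-yes (all? {n = 6} λ b → T? ((⁅ 0F ⁆ ∪ ⁅ 3F ⁆) b) →-dec (toℕ b <? 4))
    four-blocks 2F = from-yes (all? {n = 6} λ b → T? ((⁅ 1F ⁆ ∪ ⁅ 2F ⁆) b) →-dec (toℕ b <? 4))
    four-blocks 3F = from-yes (all? {n = 6} λ b → T? ((⁅ 1F ⁆ ∪ ⁅ 3F ⁆) b) →-dec (toℕ b <? 4))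
  kind (pair i s) with <-≤-connex (suc (toℕ i)) d
  ... | inj₁ i<d = core i<d (core-blocks i<d s)
    where
    core-blocks : suc (toℕ i) < d → ∀ s b → T (blocks (pair i s) b) → toℕ b < 4
    core-blocks i<d s with suc (toℕ i) <? d
    core-blocks i<d 0F | yes _ = from-yes (all? {n = 6} λ b → T? ((⁅ 0F ⁆ ∪ ⁅ 1F ⁆) b) →-dec (toℕ b <? 4))
    core-blocks i<d 1F | yes _ = from-yes (all? {n = 6} λ b → T? ((⁅ 2F ⁆ ∪ ⁅ 3F ⁆) b) →-dec (toℕ b <? 4))
    ... | no i≮d = contradiction i<d i≮d
  ... | inj₂ d≤i = extra (≤-antisym (≤-trans (toℕ<n i) m≤2h) d≤i) (extra-blocks s)
    where
    extra-blocks : ∀ s b → T (blocks (pair i s) b) → 4 ≤ toℕ b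
    extra-blocks s with suc (toℕ i) <? d
    ... | yes i<d = contradiction d≤i (<⇒≱ i<d)
    ... | no  _   = from-yes (all? {n = 6} λ b → T? ((⁅ 4F ⁆ ∪ ⁅ 5F ⁆) b) →-dec (4 ≤? toℕ b))

  colour-proper : ∀ p q b → T (blocks p b) → T (blocks q b) →
                  partIndex p ≢ partIndex q → colour p ≢ colour q
  colour-proper p q b b∈p b∈q p≢q with kind p | kind q
  ... | core _ <4   | extra _ ≥4  = contradiction (≥4 b b∈q) (<⇒≱ (<4 b b∈p))
  ... | extra _ ≥4  | core _ <4   = contradiction (≥4 b b∈p) (<⇒≱ (<4 b b∈q))
  ... | extra p≡d _ | extra q≡d _ = contradiction (trans p≡d (sym q≡d)) p≢q
  ... | core p<d _  | core q<d _  = λ eq → p≢q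
      (trans (sym (toℕ-colour p p<d)) (trans (cong toℕ eq) (toℕ-colour q q<d)))
    where
    toℕ-colour : ∀ p → partIndex p < d → toℕ (colour p) ≡ partIndex p
    toℕ-colour p p<d with partIndex p <? d
    ... | yes p<d = toℕ-fromℕ< p<d
    ... | no  p≮d = contradiction p<d p≮d

  hall : HallCondition (K4-2 m) lists
  hall = d-colourable-supports⇒hall (K4-2 m) lists (colour ∘ position m)
    (λ σ {u} {v} u~v σ∈u σ∈v → colour-proper (position m u) (position m v) (block σ)
      (lookup-lists u σ σ∈u) (lookup-lists v σ σ∈v) (adjacent⁻¹ m {u} {v} u~v))
    (λ v → ≤-reflexive (sym (∣lists∣ v)))

  lo hi : Fin 2 → Fin 6
  lo 0F = 0F
  lo 1F = 2F
  hi 0F = 1F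
  hi 1F = 3F

  side : Fin 2 → FinSet 6
  side s = ⁅ lo s ⁆ ∪ ⁅ hi s ⁆

  -- Tells apart the two blocks of either side, so that a colour of a given side is determined by
  -- this value and its offset in the block.
  side-parity : Fin 6 → Fin 2
  side-parity 0F = 0F
  side-parity 2F = 0F
  side-parity _  = 1F

  side-parity-injective : ∀ s b b′ → T (side s b) → T (side s b′) →
                          side-parity b ≡ side-parity b′ → b ≡ b′
  side-parity-injective = from-yes (all? {n = 2} λ s → all? {n = 6} λ b → all? {n = 6} λ b′ →
    T? (side s b) →-dec (T? (side s b′) →-dec ((side-parity b ≟ᶠ side-parity b′) →-dec (b ≟ᶠ b′))))

  core-side : ∀ i s b → suc (toℕ i) < d → T (blocks (pair i s) b) → T (side s b)
  core-side i s b i<d with suc (toℕ i) <? d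
  core-side i 0F b i<d | yes _ = λ b∈ → b∈
  core-side i 1F b i<d | yes _ = λ b∈ → b∈
  ... | no i≮d = contradiction i<d i≮d

  ∈-two : ∀ p q {b : Fin 6} → T ((⁅ p ⁆ ∪ ⁅ q ⁆) b) → b ≡ p ⊎ b ≡ q
  ∈-two p q {b} b∈ with Equivalence.to (T-∨ {⁅ p ⁆ b}) b∈
  ... | inj₁ h = inj₁ (toWitness h)
  ... | inj₂ h = inj₂ (toWitness h)

  not-colorable : ¬ Colorable (K4-2 m) lists
  not-colorable (ψ , ψ∈ , ψ-proper) = conflict
    where
    φ : Position m → Fin (6 * h)
    φ p = ψ (vertex m p)

    φ-proper : ∀ p q → partIndex p ≢ partIndex q → φ p ≢ φ q
    φ-proper p q p≢q = ψ-proper _ _ (adjacent p q p≢q)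

    φ-block : ∀ p → T (blocks p (block (φ p)))
    φ-block p = subst (λ q → T (blocks q (block (φ p)))) (position-vertex m p)
      (lookup-lists (vertex m p) (φ p) (∈⇒T (ψ∈ (vertex m p))))

    offset : Fin (6 * h) → Fin h
    offset σ = proj₂ (remQuot {6} h σ)

    place : Fin (6 * h) → Fin 2
    place σ = side-parity (block σ)

    -- `place` and `offset` embed the colours of one side into `Fin d`, so the pigeonhole principle
    -- forbids `suc d` distinct ones.
    too-many : ∀ s (w : Fin (suc d) → Position m) → (∀ a → T (side s (block (φ (w a))))) →
               ¬ (∀ a b → a Fin.< b → φ (w a) ≢ φ (w b))
    too-many s w in-side distinct
      with a , b , a<b , eq ← pigeonhole (n<1+n d) (λ a → combine (place (φ (w a))) (offset (φ (w a))))
      with parity≡ , offset≡ ←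
        combine-injective {2} {h} (place (φ (w a))) (offset (φ (w a)))
                                  (place (φ (w b))) (offset (φ (w b))) eq =
      distinct a b a<b (begin
        φ (w a)
          ≡⟨ combine-remQuot {6} h (φ (w a)) ⟨
        combine (block (φ (w a))) (offset (φ (w a)))
          ≡⟨ cong₂ combine (side-parity-injective s (block (φ (w a))) (block (φ (w b)))
               (in-side a) (in-side b) parity≡) offset≡ ⟩
        combine (block (φ (w b))) (offset (φ (w b)))
          ≡⟨ combine-remQuot {6} h (φ (w b)) ⟩
        φ (w b) ∎)
      where open ≡-Reasoning

    -- Two vertices of the part of size 4 and 2h − 1 pairs would need 2h + 1
    -- distinct colours among the 2h of one side.
    clash : ∀ s j j′ → block (φ (four j)) ≡ lo s → block (φ (four j′)) ≡ hi s → ⊥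
    clash s j j′ j-lo j′-hi = too-many s w in-side distinct
      where
      core-pair : Fin (pred d) → Fin m
      core-pair i = inject≤ i (s≤s⁻¹ 2h≤1+m)

      toℕ-core-pair : ∀ i → toℕ (core-pair i) ≡ toℕ i
      toℕ-core-pair i = toℕ-inject≤ i (s≤s⁻¹ 2h≤1+m)

      w : Fin (suc d) → Position m
      w 0F            = four j
      w 1F            = four j′
      w (suc (suc i)) = pair (core-pair i) s

      lo∈side : ∀ s → T (side s (lo s))
      lo∈side 0F = _
      lo∈side 1F = _

      hi∈side : ∀ s → T (side s (hi s))
      hi∈side 0F = _
      hi∈side 1F = _

      in-side : ∀ a → T (side s (block (φ (w a))))
      in-side 0F = subst (T ∘ side s) (sym j-lo) (lo∈side s)
      in-side 1F = subst (T ∘ side s) (sym j′-hi) (hi∈side s)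
      in-side (suc (suc i)) = core-side (core-pair i) s (block (φ (w (suc (suc i)))))
        (s≤s (subst (_< pred d) (sym (toℕ-core-pair i)) (toℕ<n i))) (φ-block (w (suc (suc i))))

      lo≢hi : ∀ s → lo s ≢ hi s
      lo≢hi 0F ()
      lo≢hi 1F ()

      distinct : ∀ a b → a Fin.< b → φ (w a) ≢ φ (w b)
      distinct 0F 1F _ eq = lo≢hi s (trans (sym j-lo) (trans (cong block eq) j′-hi))
      distinct 0F (suc (suc i)) _ = φ-proper (w 0F) (w (suc (suc i))) λ ()
      distinct 1F (suc (suc i)) _ = φ-proper (w 1F) (w (suc (suc i))) λ ()
      distinct (suc (suc i)) (suc (suc i′)) i<i′ =
        φ-proper (w (suc (suc i))) (w (suc (suc i′))) (λ eq → <⇒≢ (s≤s⁻¹ (s≤s⁻¹ i<i′))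
          (trans (sym (toℕ-core-pair i)) (trans (cong pred eq) (toℕ-core-pair i′))))
      distinct 1F 1F (s≤s ())
      distinct (suc (suc i)) 1F (s≤s ())

    conflict : ⊥
    -- Without a clash the part of size 4 would use at most one block of each side, but one of its
    -- four lists avoids any such choice of two blocks.
    conflict with ∈-two 0F 2F (φ-block (four 0F)) | ∈-two 0F 3F (φ-block (four 1F))
                | ∈-two 1F 2F (φ-block (four 2F)) | ∈-two 1F 3F (φ-block (four 3F))
    ... | inj₁ x₀ | _       | inj₁ x₂ | _       = clash 0F 0F 2F x₀ x₂
    ... | inj₁ x₀ | _       | inj₂ _  | inj₁ x₃ = clash 0F 0F 3F x₀ x₃
    ... | inj₁ _  | _       | inj₂ x₂ | inj₂ x₃ = clash 1F 2F 3F x₂ x₃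
    ... | inj₂ x₀ | inj₂ x₁ | _       | _       = clash 1F 0F 1F x₀ x₁
    ... | inj₂ _  | inj₁ x₁ | _       | inj₁ x₃ = clash 0F 1F 3F x₁ x₃
    ... | inj₂ x₀ | inj₁ _  | _       | inj₂ x₃ = clash 1F 0F 3F x₀ x₃

  not-hallColorable : ∀ {n} → n ≤ d → ¬ HallColorable (K4-2 m) n
  not-hallColorable n≤d colorable = not-colorable (colorable _ lists hall
    (λ v → ≤-trans n≤d (≤-reflexive (sym (∣lists∣ v)))))

-- The Hall number in both parities

lower-bound : ∀ h m n → 2 * suc h ≤ suc m → m ≤ 2 * suc h → HallColorable (K4-2 m) n → 2 * suc h < n
lower-bound h m n 2h≤1+m m≤2h colorable =
  ≰⇒> λ n≤2h → BadLists.not-hallColorable h m 2h≤1+m m≤2h {n} n≤2h colorable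

2∣n⊎2∣1+n : ∀ n → (2 ∣ n) ⊎ (2 ∣ suc n)
2∣n⊎2∣1+n zero    = inj₁ (2 ∣0)
2∣n⊎2∣1+n (suc n) = [ inj₂ ∘ ∣m∣n⇒∣m+n ∣-refl , inj₁ ]′ (2∣n⊎2∣1+n n)

positive-half : ∀ n → 2 ∣ suc n → ∃[ h ] 2 * suc h ≡ suc n
positive-half n (divides (suc h) 1+n≡) = h , trans (*-comm 2 (suc h)) (sym 1+n≡)

-- The bad lists have the even size k - 1 here, and the last pair is the one with blocks of its own.
hallNumber-odd : ∀ m h → 2 * suc h ≡ m → 2 ∤ suc m → HallNumber (K4-2 m) (suc m)
hallNumber-odd m h 2h≡m odd = s≤s z≤n , odd⇒hallColorable m odd , λ n _ colorable →
  subst (_< n) 2h≡m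
    (lower-bound h m n (≤-trans (≤-reflexive 2h≡m) (n≤1+n m)) (≤-reflexive (sym 2h≡m)) colorable)

-- The bad lists have size k itself, and every pair belongs to the core.
hallNumber-even : ∀ m h → 2 * suc h ≡ suc m → HallNumber (K4-2 m) (2 + m)
hallNumber-even m h 2h≡1+m = s≤s z≤n , hallColorable-suc m , λ n _ colorable →
  subst (_< n) 2h≡1+m
    (lower-bound h m n (≤-reflexive 2h≡1+m) (≤-trans (n≤1+n m) (≤-reflexive (sym 2h≡1+m))) colorable)

hallNumber : ∀ m → 1 ≤ m →
             (2 ∤ suc m → HallNumber (K4-2 m) (suc m)) × (2 ∣ suc m → HallNumber (K4-2 m) (2 + m))
hallNumber m@(suc m′) _ = odd-case , even-case
  where
  odd-case : 2 ∤ suc m → HallNumber (K4-2 m) (suc m)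
  odd-case odd = hallNumber-odd m (proj₁ half) (proj₂ half) odd
    where
    half : ∃[ h ] 2 * suc h ≡ m
    half = positive-half m′ ([ id , (λ even → contradiction even odd) ]′ (2∣n⊎2∣1+n m))

  even-case : 2 ∣ suc m → HallNumber (K4-2 m) (2 + m)
  even-case even = hallNumber-even m (proj₁ half) (proj₂ half)
    where
    half : ∃[ h ] 2 * suc h ≡ suc m
    half = positive-half m even

theorem4 : (k : ℕ) → 2 ≤ k →
    let G = completeMultipartite (4 ∷ replicate (k ∸ 1) 2) in
    (2 ∤ k → HallNumber G k) × (2 ∣ k → HallNumber G (suc k))
-- `hallNumber` is indexed by the number of pairs, `k ∸ 1`; the transport turns `suc (k ∸ 1)` back
-- into `k`.
theorem4 k 2≤k = subst₂ (λ G l → (2 ∤ l → HallNumber G l) × (2 ∣ l → HallNumber G (suc l)))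
  (K4-2≡ (k ∸ 1)) (m+[n∸m]≡n (≤-trans (s≤s z≤n) 2≤k)) (hallNumber (k ∸ 1) (∸-monoˡ-≤ 1 2≤k))
  where
  -- Deciding the conversion at the level of HallNumber would unfold it.
  K4-2≡ : ∀ m → K4-2 m ≡ completeMultipartite (4 ∷ replicate m 2)
  K4-2≡ m = refl
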